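{- Consider the online AdCell problem with budget constraints only, with $m$ advertisers and $n$ queries, budgets $b_i$, bids $u_{ij}$, and arrival probabilities $p_j$. Let $\overline{OPT}_B$ be the optimal value of the linear program $\overline{LP}_B$. Then the expected revenue of Algorithm A (defined in the context) is at least $\left(1-\frac1e\right)\overline{OPT}_B$. This implies that the expected revenue of Algorithm A is also at least $1-\frac1e$ of the expected revenue of the optimal offline allocation. This result holds even if the bids $u_{ij}$ are not small compared to $b_i$. Furthermore, the result holds even if the independence requirement on the arrivals of queries is relaxed and negative correlation is required instead.
   Context: Problem. There are advertisers $i\in[m]$ with budgets $b_i$, queries $j\in[n]$, and bids $u_{ij}\ge 0$ of advertiser $i$ for query $j$. Query $j$ arrives with probability $p_j$; $I_j\in\{0,1\}$ is its arrival indicator. Each query $j$ belongs to one customer and has one arrival time. Arrivals of queries with different arrival times or from different customers are independent; queries of the same customer with the same arrival time are mutually exclusive (at most one of them arrives). The parameters $p_j,u_{ij},b_i$ are known in advance. Queries arrive online in order of arrival time and, upon arrival, each must immediately be allocated to one advertiser or discarded. An allocation is $X_{ij}\in\{0,1\}$ with $\sum_i X_{ij}\le I_j$ for all $j$. Its revenue is $\sum_i\min\left(\sum_j X_{ij}u_{ij},\,b_i\right)$. The optimal offline allocation is an allocation maximizing the revenue with full knowledge of the realized $I_1,\dots,I_n$. Linear program $\overline{LP}_B$: maximize $\sum_i\sum_j x_{ij}u_{ij}$ subject to $\sum_i x_{ij}\le p_j$ for all $j\in[n]$, $\sum_j x_{ij}u_{ij}\le b_i$ for all $i\in[m]$, and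 $x_{ij}\in[0,1]$. Algorithm A: compute an optimal (possibly fractional) solution $x^*$ of $\overline{LP}_B$. Whenever query $j$ arrives, allocate it to one random advertiser, advertiser $i$ being chosen with probability $x^*_{ij}/p_j$ (and with the remaining probability $1-\sum_i x^*_{ij}/p_j$ the query is discarded), using fresh independent randomness for each query. Negative correlation: random variables $X_1,\dots,X_n$ are negatively correlated iff for any $X_i$, any subset $S\subset\{1,\dots,n\}$ not containing $i$, any constant $c$, and any two realizations $x_S\le x'_S$ of $X_S=(X_j)_{j\in S}$, one has $\Pr[X_i\le c\mid X_S=x_S]\le\Pr[X_i\le c\mid X_S=x'_S]$.
   Formalization: The formal statement adds that each bid is at most its advertiser's budget (u_ij ≤ b_i); without it the claim fails: for one advertiser and one query with p=1, u=100, b=1, Algorithm A earns 1/100 while the LP optimum and the offline optimum are 1. -}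

module Defs where

open import Algebra.Bundles using (CommutativeRing)
open import Algebra.Definitions.RawMonoid using () renaming (sum to foldSum)
import Algebra.Construct.NaturalChoice.Min as NaturalMin
import Algebra.Properties.Ring as RingProperties
import Algebra.Properties.Semiring.Mult as SemiringMult
import Algebra.Properties.Semiring.Sum as SemiringSum
open import Data.Bool.Base using (Bool; _∧_; T; if_then_else_)
open import Data.Bool.Properties using (T?)
open import Data.Fin.Base using (Fin; combine)
import Data.Fin.Base as Fin
open import Data.Fin.Properties using (all?) renaming (_≟_ to _≟F_)
open import Data.Fin.Subset using (Subset; _∈_; _∉_; _∩_)
open import Data.Fin.Subset.Properties using (_∈?_)
open import Data.Maybe.Base using (Maybe; just; nothing)
open import Data.Maybe.Properties using (≡-dec)
open import Data.Nat.Base as ℕ using (ℕ; zero; suc; _!)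
import Data.Nat.Properties as ℕₚ
open import Data.Product.Base using (∃; _×_; _,_; proj₁; proj₂)
open import Data.Sum.Base using (inj₁; inj₂)
open import Data.Vec.Base using (Vec; []; _∷_; lookup; tabulate)
open import Level using (_⊔_) renaming (suc to lsuc)
open import Relation.Binary.Bundles using (TotalOrder)
open import Relation.Binary.Core using (Rel)
open import Relation.Binary.PropositionalEquality.Core using (_≡_; _≢_)
open import Relation.Binary.Structures using (IsDecTotalOrder)
open import Relation.Nullary.Decidable.Core using (does; _×-dec_; _→-dec_)
open import Relation.Nullary.Negation.Core using (¬_)
open import Relation.Unary using (Pred; Decidable)

-- The real numbers, axiomatised classically: a Dedekind-complete totally
-- ordered field whose order is decidable (trichotomy).

record CompleteOrderedField c ℓ : Set (lsuc (c ⊔ ℓ)) where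
  field
    commutativeRing : CommutativeRing c ℓ

  open CommutativeRing commutativeRing public

  infix  4 _≤_ _<_
  infix  9 _⁻¹
  infixl 7 _/_

  field
    _≤_             : Rel Carrier ℓ
    isDecTotalOrder : IsDecTotalOrder _≈_ _≤_
    0≉1             : ¬ (0# ≈ 1#)
    +-monoʳ-≤       : ∀ x {y z} → y ≤ z → x + y ≤ x + z
    *-nonNeg        : ∀ {x y} → 0# ≤ x → 0# ≤ y → 0# ≤ x * y

    -- Total; the value at 0# is unspecified.
    _⁻¹             : Carrier → Carrier
    ⁻¹-cong         : ∀ {x y} → x ≈ y → x ⁻¹ ≈ y ⁻¹
    ⁻¹-inverseʳ     : ∀ {x} → ¬ (x ≈ 0#) → x * x ⁻¹ ≈ 1#

  IsUpperBound : Pred Carrier ℓ → Carrier → Set (c ⊔ ℓ)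
  IsUpperBound P b = ∀ {x} → P x → x ≤ b

  IsSupremum : Pred Carrier ℓ → Carrier → Set (c ⊔ ℓ)
  IsSupremum P s = IsUpperBound P s × (∀ {b} → IsUpperBound P b → s ≤ b)

  field
    supremum : (P : Pred Carrier ℓ) → ∃ P → ∃ (IsUpperBound P) → ∃ (IsSupremum P)

  _<_ : Rel Carrier ℓ
  x < y = x ≤ y × ¬ (x ≈ y)

  _/_ : Carrier → Carrier → Carrier
  x / y = x * y ⁻¹

  open IsDecTotalOrder isDecTotalOrder public
    using (isTotalOrder; _≟_; _≤?_; total; antisym)
    renaming (refl to ≤-refl; trans to ≤-trans; reflexive to ≤-reflexive)

  totalOrder : TotalOrder c ℓ ℓ
  totalOrder = record { isTotalOrder = isTotalOrder }

  open NaturalMin totalOrder public using (_⊓_)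
  open SemiringSum semiring public using (sum)
  open SemiringMult semiring public using () renaming (_×_ to _×ℕ_)

  product : ∀ {n} → (Fin n → Carrier) → Carrier
  product = foldSum *-rawMonoid

-- Euler's number, e = Σ 1/k!, as the supremum of the partial sums.

module Euler {c ℓ} (R : CompleteOrderedField c ℓ) where
  open CompleteOrderedField R
  open RingProperties ring using (-‿distribˡ-*; -‿distribʳ-*; -‿involutive)
  open SemiringMult semiring using (×-homo-+)
  open import Relation.Binary.Reasoning.Setoid setoid

  invFactorial : ℕ → Carrier
  invFactorial k = ((k !) ×ℕ 1#) ⁻¹

  partialSum : ℕ → Carrier
  partialSum zero    = 0#
  partialSum (suc k) = partialSum k + invFactorial k

  IsPartialSum : Pred Carrier ℓ
  IsPartialSum x = ∃ λ k → x ≈ partialSum k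

  private
    ≤-resp : ∀ {x x′ y y′} → x ≈ x′ → y ≈ y′ → x ≤ y → x′ ≤ y′
    ≤-resp p q x≤y = ≤-trans (≤-reflexive (sym p)) (≤-trans x≤y (≤-reflexive q))

    +-monoˡ-≤ : ∀ x {y z} → y ≤ z → y + x ≤ z + x
    +-monoˡ-≤ x y≤z = ≤-resp (+-comm x _) (+-comm x _) (+-monoʳ-≤ x y≤z)

    x≤x+y : ∀ {x y} → 0# ≤ y → x ≤ x + y
    x≤x+y {x} 0≤y = ≤-resp (+-identityʳ x) refl (+-monoʳ-≤ x 0≤y)

    0≤-+ : ∀ {x y} → 0# ≤ x → 0# ≤ y → 0# ≤ x + y
    0≤-+ 0≤x 0≤y = ≤-trans 0≤x (x≤x+y 0≤y)

    0≤-neg : ∀ {x} → x ≤ 0# → 0# ≤ - x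
    0≤-neg {x} x≤0 = ≤-resp (-‿inverseˡ x) (+-identityʳ (- x)) (+-monoʳ-≤ (- x) x≤0)

    0≤x² : ∀ x → 0# ≤ x * x
    0≤x² x with total 0# x
    ... | inj₁ 0≤x = *-nonNeg 0≤x 0≤x
    ... | inj₂ x≤0 = ≤-resp refl neg² (*-nonNeg (0≤-neg x≤0) (0≤-neg x≤0))
      where
      neg² : - x * - x ≈ x * x
      neg² = begin
        - x * - x    ≈⟨ -‿distribˡ-* x (- x) ⟨
        - (x * - x)  ≈⟨ -‿cong (sym (-‿distribʳ-* x x)) ⟩
        - - (x * x)  ≈⟨ -‿involutive (x * x) ⟩
        x * x        ∎

    0≤1 : 0# ≤ 1#
    0≤1 = ≤-resp refl (*-identityˡ 1#) (0≤x² 1#)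

    *-monoˡ-≤ : ∀ {x y z} → 0# ≤ z → x ≤ y → z * x ≤ z * y
    *-monoˡ-≤ {x} {y} {z} 0≤z x≤y =
      ≤-resp (+-identityˡ (z * x)) cancel (+-monoˡ-≤ (z * x) (*-nonNeg 0≤z 0≤y-x))
      where
      0≤y-x : 0# ≤ y - x
      0≤y-x = ≤-resp (-‿inverseʳ x) refl (+-monoˡ-≤ (- x) x≤y)
      cancel : z * (y - x) + z * x ≈ z * y
      cancel = begin
        z * (y - x) + z * x  ≈⟨ distribˡ z (y - x) x ⟨
        z * (y - x + x)      ≈⟨ *-congˡ (+-assoc y (- x) x) ⟩
        z * (y + (- x + x))  ≈⟨ *-congˡ (+-congˡ (-‿inverseˡ x)) ⟩
        z * (y + 0#)         ≈⟨ *-congˡ (+-identityʳ y) ⟩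
        z * y                ∎

    0≤×1 : ∀ n → 0# ≤ n ×ℕ 1#
    0≤×1 zero    = ≤-refl
    0≤×1 (suc n) = 0≤-+ 0≤1 (0≤×1 n)

    ×1-mono : ∀ {i j} → i ℕ.≤ j → i ×ℕ 1# ≤ j ×ℕ 1#
    ×1-mono {j = j} ℕ.z≤n = 0≤×1 j
    ×1-mono (ℕ.s≤s i≤j)   = +-monoʳ-≤ 1# (×1-mono i≤j)

    !≉0 : ∀ k → ¬ ((k !) ×ℕ 1# ≈ 0#)
    !≉0 k k!≈0 = 0≉1 (antisym 0≤1
      (≤-resp (+-identityʳ 1#) k!≈0 (×1-mono {1} (ℕₚ.1≤n! k))))

    x*x⁻²≈x⁻¹ : ∀ {x} → ¬ (x ≈ 0#) → x * (x ⁻¹ * x ⁻¹) ≈ x ⁻¹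
    x*x⁻²≈x⁻¹ {x} x≉0 = begin
      x * (x ⁻¹ * x ⁻¹)  ≈⟨ *-assoc x (x ⁻¹) (x ⁻¹) ⟨
      x * x ⁻¹ * x ⁻¹    ≈⟨ *-congʳ (⁻¹-inverseʳ x≉0) ⟩
      1# * x ⁻¹          ≈⟨ *-identityˡ (x ⁻¹) ⟩
      x ⁻¹               ∎

    0≤invFactorial : ∀ k → 0# ≤ invFactorial k
    0≤invFactorial k = ≤-resp refl (x*x⁻²≈x⁻¹ (!≉0 k)) (*-nonNeg (0≤×1 (k !)) (0≤x² (invFactorial k)))

    halve : ∀ {a b} → ¬ (a ≈ 0#) → ¬ (b ≈ 0#) → 0# ≤ a ⁻¹ → 0# ≤ b ⁻¹ →
            a + a ≤ b → b ⁻¹ + b ⁻¹ ≤ a ⁻¹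
    halve {a} {b} a≉0 b≉0 0≤a⁻¹ 0≤b⁻¹ 2a≤b =
      ≤-resp lhs rhs (*-monoˡ-≤ (*-nonNeg 0≤a⁻¹ 0≤b⁻¹) 2a≤b)
      where
      one : a ⁻¹ * b ⁻¹ * a ≈ b ⁻¹
      one = begin
        a ⁻¹ * b ⁻¹ * a    ≈⟨ *-comm _ a ⟩
        a * (a ⁻¹ * b ⁻¹)  ≈⟨ *-assoc a (a ⁻¹) (b ⁻¹) ⟨
        a * a ⁻¹ * b ⁻¹    ≈⟨ *-congʳ (⁻¹-inverseʳ a≉0) ⟩
        1# * b ⁻¹          ≈⟨ *-identityˡ (b ⁻¹) ⟩
        b ⁻¹               ∎
      lhs : a ⁻¹ * b ⁻¹ * (a + a) ≈ b ⁻¹ + b ⁻¹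
      lhs = trans (distribˡ _ a a) (+-cong one one)
      rhs : a ⁻¹ * b ⁻¹ * b ≈ a ⁻¹
      rhs = begin
        a ⁻¹ * b ⁻¹ * b    ≈⟨ *-assoc (a ⁻¹) (b ⁻¹) b ⟩
        a ⁻¹ * (b ⁻¹ * b)  ≈⟨ *-congˡ (*-comm (b ⁻¹) b) ⟩
        a ⁻¹ * (b * b ⁻¹)  ≈⟨ *-congˡ (⁻¹-inverseʳ b≉0) ⟩
        a ⁻¹ * 1#          ≈⟨ *-identityʳ (a ⁻¹) ⟩
        a ⁻¹               ∎

    invFactorial-halves : ∀ k → invFactorial (2 ℕ.+ k) + invFactorial (2 ℕ.+ k) ≤ invFactorial (1 ℕ.+ k)
    invFactorial-halves k = halve (!≉0 (1 ℕ.+ k)) (!≉0 (2 ℕ.+ k))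
                         (0≤invFactorial (1 ℕ.+ k)) (0≤invFactorial (2 ℕ.+ k))
      (≤-resp (×-homo-+ 1# ((1 ℕ.+ k) !) ((1 ℕ.+ k) !)) refl
        (×1-mono (ℕₚ.+-monoʳ-≤ ((1 ℕ.+ k) !) (ℕₚ.m≤m+n ((1 ℕ.+ k) !) _))))

    bound : Carrier
    bound = partialSum 2 + invFactorial 1

    tail-bound : ∀ k → partialSum (2 ℕ.+ k) + invFactorial (1 ℕ.+ k) ≤ bound
    tail-bound zero    = ≤-refl
    tail-bound (suc k) =
      ≤-trans (≤-trans (≤-reflexive (+-assoc _ _ _)) (+-monoʳ-≤ _ (invFactorial-halves k)))
              (tail-bound k)

    partialSum≤bound : ∀ k → partialSum k ≤ bound
    partialSum≤bound k =
      ≤-trans (x≤x+y (0≤invFactorial k)) (≤-trans (x≤x+y (0≤invFactorial (1 ℕ.+ k)))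
        (≤-trans (x≤x+y (0≤invFactorial (1 ℕ.+ k))) (tail-bound k)))

  e-supremum : ∃ (IsSupremum IsPartialSum)
  e-supremum = supremum IsPartialSum (partialSum 0 , 0 , refl)
    (bound , λ (k , x≈) → ≤-trans (≤-reflexive x≈) (partialSum≤bound k))

  e : Carrier
  e = proj₁ e-supremum

module Probability {c ℓ} (R : CompleteOrderedField c ℓ) where
  open CompleteOrderedField R

  indicator : Bool → Carrier
  indicator b = if b then 1# else 0#

  record FiniteProbabilitySpace : Set (c ⊔ ℓ) where
    field
      size        : ℕ
      mass        : Fin size → Carrier
      mass-nonNeg : ∀ ω → 0# ≤ mass ω
      mass-total  : sum mass ≈ 1#

    Ω : Set
    Ω = Fin size

    𝔼 : (Ω → Carrier) → Carrier
    𝔼 X = sum λ ω → mass ω * X ω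

    ℙ : ∀ {p} {E : Pred Ω p} → Decidable E → Carrier
    ℙ E? = 𝔼 λ ω → indicator (does (E? ω))

    ℙ[_∣_] : ∀ {p q} {E : Pred Ω p} {F : Pred Ω q} →
             Decidable E → Decidable F → Carrier
    ℙ[ E? ∣ F? ] = ℙ (λ ω → E? ω ×-dec F? ω) / ℙ F?

    MutuallyIndependent : ∀ {a} {A : Set a} {k} → (Fin k → Ω → A) → Set (a ⊔ ℓ)
    MutuallyIndependent {A = A} {k} Y =
      (B : Fin k → A → Bool) →
      ℙ (λ ω → all? λ g → T? (B g (Y g ω))) ≈
      product λ g → ℙ (λ ω → T? (B g (Y g ω)))

    -- The event X_S = x_S; coordinates of x outside S are irrelevant.
    agreesOn : ∀ {k} (X : Fin k → Ω → Carrier) (S : Subset k) (x : Fin k → Carrier) →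
               Decidable (λ ω → ∀ j → j ∈ S → X j ω ≈ x j)
    agreesOn X S x ω = all? λ j → (j ∈? S) →-dec (X j ω ≟ x j)

    NegativelyCorrelated : ∀ {k} → (Fin k → Ω → Carrier) → Set (c ⊔ ℓ)
    NegativelyCorrelated {k} X =
      ∀ (i : Fin k) (S : Subset k) → i ∉ S →
      ∀ (a : Carrier) (x x′ : Fin k → Carrier) →
      (∀ j → j ∈ S → x j ≤ x′ j) →
      0# < ℙ (agreesOn X S x) → 0# < ℙ (agreesOn X S x′) →
      ℙ[ (λ ω → X i ω ≤? a) ∣ agreesOn X S x ] ≤
      ℙ[ (λ ω → X i ω ≤? a) ∣ agreesOn X S x′ ]

module AdCell {c ℓ} (R : CompleteOrderedField c ℓ) where
  open CompleteOrderedField R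
  open Probability R
  open FiniteProbabilitySpace using (Ω; 𝔼; ℙ; MutuallyIndependent)

  record Instance (m n : ℕ) : Set (c ⊔ ℓ) where
    field
      budget     : Fin m → Carrier
      bid        : Fin m → Fin n → Carrier
      prob       : Fin n → Carrier
      bid-nonNeg : ∀ i j → 0# ≤ bid i j
      -- An advertiser never pays more than its budget for a single query.
      -- Without this the bound fails: for one query with probability 1, bid
      -- 100 and budget 1, the algorithm earns 1/100 while both optima are 1.
      bid≤budget : ∀ i j → bid i j ≤ budget i
      space      : FiniteProbabilitySpace
      arrivals   : Ω space → Subset n
      marginal   : ∀ j → ℙ space (λ ω → j ∈? arrivals ω) ≈ prob j

  module _ {m n : ℕ} (𝓘 : Instance m n) where
    open Instance 𝓘

    arrivalIndicator : Fin n → Ω space → Carrier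
    arrivalIndicator j ω = indicator (lookup (arrivals ω) j)

    -- Only the labels of customers and of arrival times matter; a slot is a
    -- (customer, arrival time) pair.
    record CustomerArrivals : Set (c ⊔ ℓ) where
      field
        #customers #times : ℕ
        customer : Fin n → Fin #customers
        time     : Fin n → Fin #times

      slot : Fin n → Fin (#customers ℕ.* #times)
      slot j = combine (customer j) (time j)

      queriesIn : Fin (#customers ℕ.* #times) → Subset n
      queriesIn g = tabulate λ j → does (slot j ≟F g)

      field
        independent : MutuallyIndependent space λ g ω → arrivals ω ∩ queriesIn g
        exclusive   : ∀ {j k} → j ≢ k → customer j ≡ customer k → time j ≡ time k →
                      ℙ space (λ ω → (j ∈? arrivals ω) ×-dec (k ∈? arrivals ω)) ≈ 0#

    NegativelyCorrelatedArrivals : Set (c ⊔ ℓ)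
    NegativelyCorrelatedArrivals =
      FiniteProbabilitySpace.NegativelyCorrelated space arrivalIndicator

    Allocation : Set
    Allocation = Fin m → Fin n → Bool

    IsAllocationFor : Subset n → Allocation → Set ℓ
    IsAllocationFor I X =
      ∀ j → sum (λ i → indicator (X i j)) ≤ indicator (lookup I j)

    revenue : Allocation → Carrier
    revenue X = sum λ i → sum (λ j → indicator (X i j) * bid i j) ⊓ budget i

    IsOptimalOffline : (Subset n → Allocation) → Set ℓ
    IsOptimalOffline opt = ∀ I →
      IsAllocationFor I (opt I) ×
      (∀ X → IsAllocationFor I X → revenue X ≤ revenue (opt I))

    expectedOfflineRevenue : (Subset n → Allocation) → Carrier
    expectedOfflineRevenue opt = 𝔼 space λ ω → revenue (opt (arrivals ω))

    Fractional : Set c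
    Fractional = Fin m → Fin n → Carrier

    record IsFeasible (x : Fractional) : Set (c ⊔ ℓ) where
      field
        query-constraint  : ∀ j → sum (λ i → x i j) ≤ prob j
        budget-constraint : ∀ i → sum (λ j → x i j * bid i j) ≤ budget i
        nonNeg            : ∀ i j → 0# ≤ x i j
        ≤1                : ∀ i j → x i j ≤ 1#

    lpValue : Fractional → Carrier
    lpValue x = sum λ i → sum λ j → x i j * bid i j

    IsOptimalLP : Fractional → Set (c ⊔ ℓ)
    IsOptimalLP x = IsFeasible x × (∀ y → IsFeasible y → lpValue y ≤ lpValue x)

    -- A choice is the advertiser picked for a query, or nothing if the query
    -- is discarded.  When prob j ≈ 0# feasibility forces x i j ≈ 0#, so the
    -- unspecified inverse of 0# plays no role.
    choiceProb : Fractional → Fin n → Maybe (Fin m) → Carrier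
    choiceProb x j (just i) = x i j / prob j
    choiceProb x j nothing  = 1# - sum λ i → x i j / prob j

    -- Expectation of f (d₁, …, dₖ) for independent dⱼ with law q j.
    𝔼-choices : ∀ {k} → (Fin k → Maybe (Fin m) → Carrier) →
                (Vec (Maybe (Fin m)) k → Carrier) → Carrier
    𝔼-choices {zero}  q f = f []
    𝔼-choices {suc k} q f = branch nothing + sum λ i → branch (just i)
      where
      branch : Maybe (Fin m) → Carrier
      branch d = q Fin.zero d * 𝔼-choices (λ j → q (Fin.suc j)) (λ ds → f (d ∷ ds))

    -- Choices are drawn for all queries, independently of the arrivals, and
    -- used only for the queries that arrive.
    allocate : Subset n → Vec (Maybe (Fin m)) n → Allocation
    allocate I d i j = lookup I j ∧ does (≡-dec _≟F_ (lookup d j) (just i))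

    expectedRevenueA : Fractional → Carrier
    expectedRevenueA x = 𝔼 space λ ω →
      𝔼-choices (choiceProb x) λ d → revenue (allocate (arrivals ω) d)

{-# OPTIONS --safe #-}
module Submission where

open import Algebra.Bundles using (CommutativeRing)
import Algebra.Construct.NaturalChoice.Min as NaturalMin
import Algebra.Construct.NaturalChoice.MinOp as MinOp
import Algebra.Properties.CommutativeMonoid.Sum as CommutativeMonoidSum
import Algebra.Properties.Ring as RingProperties
import Algebra.Properties.Semiring.Exp as SemiringExp
import Algebra.Properties.Semiring.Mult as SemiringMult
import Algebra.Properties.Semiring.Mult.TCOptimised as SemiringMultTC
import Algebra.Properties.Semiring.Sum as SemiringSum
import Algebra.Solver.Ring as RingSolver
open import Algebra.Solver.Ring.AlmostCommutativeRing
  using (fromCommutativeRing; _-Raw-AlmostCommutative⟶_)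
open import Data.Bool.Base using (Bool; true; false; _∧_; _∨_; not)
open import Data.Bool.Properties using (T?)
open import Data.Empty using (⊥-elim)
open import Data.Fin.Base using (Fin; zero; suc)
open import Data.Fin.Properties using (all?; combine-injective) renaming (_≟_ to _≟F_)
open import Data.Fin.Subset using (Subset; inside; outside; _∈_; _∉_; _∩_)
open import Data.Fin.Subset.Properties using (_∈?_; drop-there)
open import Data.Integer.Base as ℤ using (ℤ; +_; -[1+_]; _⊖_)
import Data.Integer.Properties as ℤₚ
open import Data.Maybe.Base as Maybe using (Maybe; just; nothing)
open import Data.Maybe.Properties using (≡-dec)
open import Data.Nat.Base as ℕ using (ℕ; zero; suc; _!)
import Data.Nat.Properties as ℕₚ
open import Data.Product.Base using (∃; _×_; _,_; proj₁; proj₂)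
open import Data.Sum.Base using (_⊎_; inj₁; inj₂)
open import Data.Vec.Base using (Vec; []; _∷_; lookup; tabulate)
import Data.Vec.Functional as Vector
open import Data.Vec.Properties using (lookup∘tabulate; lookup-zipWith)
open import Function.Base using (_∘_; const)
open import Level using (_⊔_)
open import Relation.Binary.Bundles using (TotalOrder)
open import Relation.Binary.PropositionalEquality as ≡ using (_≡_; _≢_)
open import Relation.Nullary.Decidable
  using (yes; no; does; dec-true; dec-false; dec⇒maybe; _×-dec_; _→-dec_)
open import Relation.Nullary.Negation.Core using (¬_)
open import Relation.Unary using (Pred; Decidable)
open import Defs

-- For advertiser i let aᵢⱼ = uᵢⱼ / bᵢ ∈ [0, 1]. If Xᵢⱼ indicates that i receives
-- query j, then min (Σⱼ Xᵢⱼ uᵢⱼ, bᵢ) ≥ bᵢ (1 - ∏ⱼ (1 - aᵢⱼ Xᵢⱼ)). Averaging over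
-- the choices turns Xᵢⱼ into Iⱼ x*ᵢⱼ / pⱼ, so it remains to bound
-- 𝔼 ∏ⱼ (1 - zⱼ Iⱼ) by ∏ⱼ (1 - zⱼ pⱼ) for z ∈ [0, 1]ⁿ. Both sides are multiaffine
-- in z, so this reduces to z ∈ {0, 1}ⁿ, that is, to
-- ℙ (no query of T arrives) ≤ ∏_{j ∈ T} (1 - pⱼ), which either hypothesis on the
-- arrivals implies. Finally 1 - ∏ⱼ (1 - wⱼ) ≥ (1 - 1/e) Σⱼ wⱼ when Σⱼ wⱼ ≤ 1.
-- The LP optimum bounds the offline revenue because averaging an offline
-- allocation, scaled down to the budgets, yields a feasible LP solution.

-- The two sources of randomness are separated. For fixed arrivals the choices are independent, so
-- the expectation of each product over queries factors exactly; dependence remains only among the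
-- arrivals, and there the weights are the constants `zⱼ = aᵢⱼ x*ᵢⱼ / pⱼ`. The product lower bound
-- for the minimum asks only for `uᵢⱼ ≤ bᵢ`, which is why bids need not be small. Negative
-- correlation enters through the all-zero outcome: among all values of `X_S` it makes the absence
-- of a further query least likely, so conditioning on no arrival in S can only lower that
-- probability. The constant needs care because `e` is given only as a supremum of partial sums,
-- without an exponential function. In place of `1 - w ≤ exp (- w)`, products are compared with
-- truncated exponential series, and the supremum is taken at the very end, at total weight 1.

-- Ring identities with integer coefficients.

module IntegerSolver {c ℓ} (R : CommutativeRing c ℓ) where
  open CommutativeRing R
  open RingProperties ring
  open SemiringMultTC semiring using (×-homo-+; ×1-homo-*; 1+×) renaming (_×_ to _×ℕ_)
  open import Relation.Binary.Reasoning.Setoid setoid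

  -- Integer coefficients have decidable equality, so the solver can cancel terms. With the
  -- optimised multiple, `1 ×ℕ 1#` computes to `1#`, so `con (+ 1)` in a solver goal denotes `1#`
  -- itself.
  fromℤ : ℤ → Carrier
  fromℤ (+ n)    = n ×ℕ 1#
  fromℤ -[1+ n ] = - (suc n ×ℕ 1#)

  neg-homo : ∀ i → fromℤ (ℤ.- i) ≈ - fromℤ i
  neg-homo (+ zero)  = sym -0#≈0#
  neg-homo (+ suc n) = refl
  neg-homo -[1+ n ]  = sym (-‿involutive _)

  cancel-1 : ∀ x y → (1# + x) - (1# + y) ≈ x - y
  cancel-1 x y = begin
    (1# + x) - (1# + y)      ≈⟨ +-cong (+-comm x 1#) (-‿+-comm 1# y) ⟨
    (x + 1#) + (- 1# + - y)  ≈⟨ +-assoc x 1# _ ⟩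
    x + (1# + (- 1# + - y))  ≈⟨ +-congˡ (+-assoc 1# _ _) ⟨
    x + (1# + - 1# + - y)    ≈⟨ +-congˡ (+-congʳ (-‿inverseʳ 1#)) ⟩
    x + (0# + - y)           ≈⟨ +-congˡ (+-identityˡ _) ⟩
    x - y                    ∎

  ⊖-homo : ∀ m n → fromℤ (m ⊖ n) ≈ m ×ℕ 1# - n ×ℕ 1#
  ⊖-homo m       zero    = sym (trans (+-congˡ -0#≈0#) (+-identityʳ _))
  ⊖-homo zero    (suc n) = sym (+-identityˡ _)
  ⊖-homo (suc m) (suc n) = begin
    fromℤ (suc m ⊖ suc n)              ≡⟨ ≡.cong fromℤ (ℤₚ.[1+m]⊖[1+n]≡m⊖n m n) ⟩
    fromℤ (m ⊖ n)                      ≈⟨ ⊖-homo m n ⟩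
    m ×ℕ 1# - n ×ℕ 1#                  ≈⟨ cancel-1 _ _ ⟨
    (1# + m ×ℕ 1#) - (1# + n ×ℕ 1#)    ≈⟨ +-cong (1+× m 1#) (-‿cong (1+× n 1#)) ⟨
    suc m ×ℕ 1# - suc n ×ℕ 1#          ∎

  +-homo : ∀ i j → fromℤ (i ℤ.+ j) ≈ fromℤ i + fromℤ j
  +-homo (+ m)    (+ n)    = ×-homo-+ 1# m n
  +-homo (+ m)    -[1+ n ] = ⊖-homo m (suc n)
  +-homo -[1+ m ] (+ n)    = trans (⊖-homo n (suc m)) (+-comm _ _)
  +-homo -[1+ m ] -[1+ n ] = begin
    - (suc (suc (m ℕ.+ n)) ×ℕ 1#)          ≡⟨ ≡.cong (λ k → - (suc k ×ℕ 1#)) (ℕₚ.+-suc m n) ⟨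
    - ((suc m ℕ.+ suc n) ×ℕ 1#)            ≈⟨ -‿cong (×-homo-+ 1# (suc m) (suc n)) ⟩
    - (suc m ×ℕ 1# + suc n ×ℕ 1#)          ≈⟨ -‿+-comm _ _ ⟨
    - (suc m ×ℕ 1#) - suc n ×ℕ 1#          ∎

  pos-*-homo : ∀ m j → fromℤ (+ m ℤ.* j) ≈ fromℤ (+ m) * fromℤ j
  pos-*-homo m (+ n) = begin
    fromℤ (+ m ℤ.* + n)     ≡⟨ ≡.cong fromℤ (ℤₚ.pos-* m n) ⟨
    (m ℕ.* n) ×ℕ 1#         ≈⟨ ×1-homo-* m n ⟩
    m ×ℕ 1# * n ×ℕ 1#       ∎
  pos-*-homo m -[1+ n ] = begin
    fromℤ (+ m ℤ.* -[1+ n ])       ≡⟨ ≡.cong fromℤ (ℤₚ.neg-distribʳ-* (+ m) (+ suc n)) ⟨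
    fromℤ (ℤ.- (+ m ℤ.* + suc n))  ≈⟨ neg-homo (+ m ℤ.* + suc n) ⟩
    - fromℤ (+ m ℤ.* + suc n)      ≈⟨ -‿cong (pos-*-homo m (+ suc n)) ⟩
    - (m ×ℕ 1# * suc n ×ℕ 1#)      ≈⟨ -‿distribʳ-* _ _ ⟩
    m ×ℕ 1# * - (suc n ×ℕ 1#)      ∎

  *-homo : ∀ i j → fromℤ (i ℤ.* j) ≈ fromℤ i * fromℤ j
  *-homo (+ m)    j = pos-*-homo m j
  *-homo -[1+ m ] j = begin
    fromℤ (-[1+ m ] ℤ.* j)         ≡⟨ ≡.cong fromℤ (ℤₚ.neg-distribˡ-* (+ suc m) j) ⟨
    fromℤ (ℤ.- (+ suc m ℤ.* j))    ≈⟨ neg-homo (+ suc m ℤ.* j) ⟩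
    - fromℤ (+ suc m ℤ.* j)        ≈⟨ -‿cong (pos-*-homo (suc m) j) ⟩
    - (suc m ×ℕ 1# * fromℤ j)      ≈⟨ -‿distribˡ-* _ _ ⟩
    - (suc m ×ℕ 1#) * fromℤ j      ∎

  fromℤ-morphism : ℤ.+-*-rawRing -Raw-AlmostCommutative⟶ fromCommutativeRing R
  fromℤ-morphism = record
    { ⟦_⟧    = fromℤ
    ; +-homo = +-homo
    ; *-homo = *-homo
    ; -‿homo = neg-homo
    ; 0-homo = refl
    ; 1-homo = refl
    }

  open RingSolver ℤ.+-*-rawRing (fromCommutativeRing R) fromℤ-morphism
    (λ i j → Maybe.map (λ i≡j → reflexive (≡.cong fromℤ i≡j)) (dec⇒maybe (i ℤₚ.≟ j)))
    public using (solve; _:=_; _:+_; _:*_; _:-_; :-_; con)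

-- Inequalities in an ordered field and products of complements.

module OrderedField {c ℓ} (R : CompleteOrderedField c ℓ) where
  open CompleteOrderedField R hiding (zero)
  open IntegerSolver commutativeRing using (solve; _:=_; _:+_; _:*_; _:-_; con)
  open CommutativeMonoidSum *-commutativeMonoid using ()
    renaming (sum-cong-≋ to product-cong)
  open import Relation.Binary.Reasoning.PartialOrder (TotalOrder.poset totalOrder)

  -- Turns an inequality into a task for the solver: name the slack `d` as a combination of visibly
  -- nonnegative terms and check an identity.
  ≤-by : ∀ {x y d} → 0# ≤ d → y ≈ x + d → x ≤ y
  ≤-by {x} {y} {d} 0≤d y≈x+d = begin
    x       ≈⟨ +-identityʳ x ⟨
    x + 0#  ≤⟨ +-monoʳ-≤ x 0≤d ⟩
    x + d   ≈⟨ y≈x+d ⟨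
    y       ∎

  x≤y⇒0≤y-x : ∀ {x y} → x ≤ y → 0# ≤ y - x
  x≤y⇒0≤y-x {x} {y} x≤y = begin
    0#       ≈⟨ -‿inverseˡ x ⟨
    - x + x  ≤⟨ +-monoʳ-≤ (- x) x≤y ⟩
    - x + y  ≈⟨ +-comm (- x) y ⟩
    y - x    ∎

  +-mono-≤ : ∀ {x y u v} → x ≤ y → u ≤ v → x + u ≤ y + v
  +-mono-≤ {x} {y} {u} {v} x≤y u≤v = begin
    x + u  ≤⟨ +-monoʳ-≤ x u≤v ⟩
    x + v  ≈⟨ +-comm x v ⟩
    v + x  ≤⟨ +-monoʳ-≤ v x≤y ⟩
    v + y  ≈⟨ +-comm v y ⟩
    y + v  ∎

  +-nonNeg : ∀ {x y} → 0# ≤ x → 0# ≤ y → 0# ≤ x + y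
  +-nonNeg {x} 0≤x 0≤y = ≤-trans 0≤x (≤-by 0≤y refl)

  *-monoˡ-≤ : ∀ {z x y} → 0# ≤ z → x ≤ y → z * x ≤ z * y
  *-monoˡ-≤ {z} {x} {y} 0≤z x≤y = ≤-by (*-nonNeg 0≤z (x≤y⇒0≤y-x x≤y))
    (solve 3 (λ z x y → z :* y := z :* x :+ z :* (y :- x)) refl z x y)

  *-monoʳ-≤ : ∀ {z x y} → 0# ≤ z → x ≤ y → x * z ≤ y * z
  *-monoʳ-≤ {z} {x} {y} 0≤z x≤y = begin
    x * z  ≈⟨ *-comm x z ⟩
    z * x  ≤⟨ *-monoˡ-≤ 0≤z x≤y ⟩
    z * y  ≈⟨ *-comm z y ⟩
    y * z  ∎

  x*y≤x : ∀ {x y} → 0# ≤ x → y ≤ 1# → x * y ≤ x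
  x*y≤x 0≤x y≤1 = ≤-trans (*-monoˡ-≤ 0≤x y≤1) (≤-reflexive (*-identityʳ _))

  *-≤1 : ∀ {x y} → 0# ≤ x → x ≤ 1# → y ≤ 1# → x * y ≤ 1#
  *-≤1 0≤x x≤1 y≤1 = ≤-trans (x*y≤x 0≤x y≤1) x≤1

  1-x≤1 : ∀ {x} → 0# ≤ x → 1# - x ≤ 1#
  1-x≤1 {x} 0≤x = ≤-by 0≤x (solve 1 (λ x → con (+ 1) := con (+ 1) :- x :+ x) refl x)

  1-mono-≥ : ∀ {x y} → x ≤ y → 1# - y ≤ 1# - x
  1-mono-≥ {x} {y} x≤y = ≤-by (x≤y⇒0≤y-x x≤y)
    (solve 2 (λ x y → con (+ 1) :- x := con (+ 1) :- y :+ (y :- x)) refl x y)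

  1-cong : ∀ {x y} → x ≈ y → 1# - x ≈ 1# - y
  1-cong x≈y = +-congˡ (-‿cong x≈y)

  1-0≈1 : 1# - 0# ≈ 1#
  1-0≈1 = solve 0 (con (+ 1) :- con (+ 0) := con (+ 1)) refl

  0≤1 : 0# ≤ 1#
  0≤1 with total 0# 1#
  ... | inj₁ 0≤1 = 0≤1
  ... | inj₂ 1≤0 = begin
    0#                      ≤⟨ *-nonNeg (x≤y⇒0≤y-x 1≤0) (x≤y⇒0≤y-x 1≤0) ⟩
    (0# - 1#) * (0# - 1#)   ≈⟨ solve 0 ((con (+ 0) :- con (+ 1)) :* (con (+ 0) :- con (+ 1)) := con (+ 1)) refl ⟩
    1#                      ∎

  -- If `1# ≤ y`, then `x ≤ x * y ≤ x`, and cancelling `x` leaves `y ≈ 1#`.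
  *-cancelˡ-≤1 : ∀ {x y} → 0# ≤ x → ¬ (x ≈ 0#) → x * y ≤ x → y ≤ 1#
  *-cancelˡ-≤1 {x} {y} 0≤x x≉0 xy≤x with total y 1#
  ... | inj₁ y≤1 = y≤1
  ... | inj₂ 1≤y = ≤-reflexive (begin-equality
    y               ≈⟨ *-identityˡ y ⟨
    1# * y          ≈⟨ *-congʳ (⁻¹-inverseʳ x≉0) ⟨
    x * x ⁻¹ * y    ≈⟨ solve 3 (λ x i y → x :* i :* y := i :* (x :* y)) refl x (x ⁻¹) y ⟩
    x ⁻¹ * (x * y)  ≈⟨ *-congˡ (antisym xy≤x (≤-trans (≤-reflexive (sym (*-identityʳ x))) (*-monoˡ-≤ 0≤x 1≤y))) ⟩
    x ⁻¹ * x        ≈⟨ *-comm _ _ ⟩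
    x * x ⁻¹        ≈⟨ ⁻¹-inverseʳ x≉0 ⟩
    1#              ∎)

  ⁻¹-nonNeg : ∀ {x} → 0# ≤ x → ¬ (x ≈ 0#) → 0# ≤ x ⁻¹
  ⁻¹-nonNeg {x} 0≤x x≉0 with total 0# (x ⁻¹)
  ... | inj₁ 0≤x⁻¹ = 0≤x⁻¹
  ... | inj₂ x⁻¹≤0 = ⊥-elim (0≉1 (antisym 0≤1 (begin
    1#        ≈⟨ ⁻¹-inverseʳ x≉0 ⟨
    x * x ⁻¹  ≤⟨ *-monoˡ-≤ 0≤x x⁻¹≤0 ⟩
    x * 0#    ≈⟨ zeroʳ x ⟩
    0#        ∎)))

  /-*-cancel : ∀ x {y} → ¬ (y ≈ 0#) → x / y * y ≈ x
  /-*-cancel x {y} y≉0 = begin-equality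
    x / y * y       ≈⟨ solve 3 (λ x y i → x :* i :* y := x :* (y :* i)) refl x y (y ⁻¹) ⟩
    x * (y * y ⁻¹)  ≈⟨ *-congˡ (⁻¹-inverseʳ y≉0) ⟩
    x * 1#          ≈⟨ *-identityʳ x ⟩
    x               ∎

  /-≤1 : ∀ {x y} → 0# ≤ y → ¬ (y ≈ 0#) → x ≤ y → x / y ≤ 1#
  /-≤1 0≤y y≉0 x≤y = ≤-trans (*-monoʳ-≤ (⁻¹-nonNeg 0≤y y≉0) x≤y) (≤-reflexive (⁻¹-inverseʳ y≉0))

  -- An existential instead of `x / y`, so that budgets and spendings may be zero: if `y` vanishes,
  -- so does `x`, and `r = 0#` serves.
  ratio : ∀ {x y} → 0# ≤ x → x ≤ y → ∃ λ r → 0# ≤ r × r ≤ 1# × r * y ≈ x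
  ratio {x} {y} 0≤x x≤y with y ≟ 0#
  ... | yes y≈0 = 0# , ≤-refl , 0≤1 , trans (zeroˡ y) (antisym 0≤x (≤-trans x≤y (≤-reflexive y≈0)))
  ... | no  y≉0 = x / y , *-nonNeg 0≤x (⁻¹-nonNeg 0≤y y≉0) , /-≤1 0≤y y≉0 x≤y , /-*-cancel x y≉0
    where 0≤y = ≤-trans 0≤x x≤y

  open MinOp (NaturalMin.minOperator totalOrder) public using (x⊓y≤x; x⊓y≤y; ⊓-glb; ⊓-monoˡ-≤)

  sum-mono-≤ : ∀ {n} {f g : Fin n → Carrier} → (∀ i → f i ≤ g i) → sum f ≤ sum g
  sum-mono-≤ {zero}  f≤g = ≤-refl
  sum-mono-≤ {suc n} f≤g = +-mono-≤ (f≤g zero) (sum-mono-≤ (f≤g ∘ suc))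

  sum-nonNeg : ∀ {n} {f : Fin n → Carrier} → (∀ i → 0# ≤ f i) → 0# ≤ sum f
  sum-nonNeg {zero}  0≤f = ≤-refl
  sum-nonNeg {suc n} 0≤f = +-nonNeg (0≤f zero) (sum-nonNeg (0≤f ∘ suc))

  term≤sum : ∀ {n} {f : Fin n → Carrier} → (∀ i → 0# ≤ f i) → ∀ i → f i ≤ sum f
  term≤sum 0≤f zero = ≤-by (sum-nonNeg (0≤f ∘ suc)) refl
  term≤sum {f = f} 0≤f (suc i) =
    ≤-trans (term≤sum (0≤f ∘ suc) i) (≤-by (0≤f zero) (+-comm (f zero) _))

  product-nonNeg : ∀ {n} {f : Fin n → Carrier} → (∀ i → 0# ≤ f i) → 0# ≤ product f
  product-nonNeg {zero}  0≤f = 0≤1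
  product-nonNeg {suc n} 0≤f = *-nonNeg (0≤f zero) (product-nonNeg (0≤f ∘ suc))

  product-mono-≤ : ∀ {n} {f g : Fin n → Carrier} → (∀ i → 0# ≤ f i) → (∀ i → f i ≤ g i) →
                   product f ≤ product g
  product-mono-≤ {zero}  0≤f f≤g = ≤-refl
  product-mono-≤ {suc n} 0≤f f≤g = ≤-trans
    (*-monoʳ-≤ (product-nonNeg (0≤f ∘ suc)) (f≤g zero))
    (*-monoˡ-≤ (≤-trans (0≤f zero) (f≤g zero)) (product-mono-≤ (0≤f ∘ suc) (f≤g ∘ suc)))

  product-≤1 : ∀ {n} {f : Fin n → Carrier} → (∀ i → 0# ≤ f i) → (∀ i → f i ≤ 1#) → product f ≤ 1#
  product-≤1 {zero}  0≤f f≤1 = ≤-refl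
  product-≤1 {suc n} 0≤f f≤1 = *-≤1 (0≤f zero) (f≤1 zero) (product-≤1 (0≤f ∘ suc) (f≤1 ∘ suc))

  UnitInterval : Carrier → Set _
  UnitInterval x = 0# ≤ x × x ≤ 1#

  1-unit : ∀ {x} → UnitInterval x → UnitInterval (1# - x)
  1-unit (0≤x , x≤1) = x≤y⇒0≤y-x x≤1 , 1-x≤1 0≤x

  *-unit : ∀ {x y} → UnitInterval x → UnitInterval y → UnitInterval (x * y)
  *-unit (0≤x , x≤1) (0≤y , y≤1) = *-nonNeg 0≤x 0≤y , *-≤1 0≤x x≤1 y≤1

  -- For indicators `v` this is the indicator that none of the events occurs.
  complements : ∀ {n} → (Fin n → Carrier) → Carrier
  complements v = product λ j → 1# - v j

  complements-unit : ∀ {n} {v : Fin n → Carrier} → (∀ j → UnitInterval (v j)) →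
                     UnitInterval (complements v)
  complements-unit v∈I =
    product-nonNeg (proj₁ ∘ 1-unit ∘ v∈I) , product-≤1 (proj₁ ∘ 1-unit ∘ v∈I) (proj₂ ∘ 1-unit ∘ v∈I)

  complements-cong : ∀ {n} {v w : Fin n → Carrier} → (∀ j → v j ≈ w j) → complements v ≈ complements w
  complements-cong v≈w = product-cong (1-cong ∘ v≈w)

  -- The Weierstrass product inequality. A new factor `1# - x` adds slack `x * (1# - p)` to that of
  -- the remaining product `p`.
  1-sum≤complements : ∀ {n} {v : Fin n → Carrier} → (∀ j → UnitInterval (v j)) →
                      1# - sum v ≤ complements v
  1-sum≤complements {zero}  v∈I = ≤-reflexive 1-0≈1
  1-sum≤complements {suc n} {v} v∈I = ≤-by
    (+-nonNeg (x≤y⇒0≤y-x (1-sum≤complements (v∈I ∘ suc)))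
              (*-nonNeg (proj₁ (v∈I zero)) (proj₁ (1-unit (complements-unit (v∈I ∘ suc))))))
    (solve 3 (λ x s p → (con (+ 1) :- x) :* p :=
                        con (+ 1) :- (x :+ s) :+ ((p :- (con (+ 1) :- s)) :+ x :* (con (+ 1) :- p)))
           refl (v zero) (sum (v ∘ suc)) (complements (v ∘ suc)))

  -- The product is convex in `t` on the unit interval, so it lies below the chord joining its
  -- values at 0 and 1. The induction exhibits the slack and needs no calculus.
  complements-chord : ∀ {n} {v : Fin n → Carrier} {t} → UnitInterval t → (∀ j → UnitInterval (v j)) →
                      complements (λ j → t * v j) ≤ 1# - t + t * complements v
  complements-chord {zero}  {v} {t} t∈I v∈I =
    ≤-reflexive (solve 1 (λ t → con (+ 1) := con (+ 1) :- t :+ t :* con (+ 1)) refl t)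
  complements-chord {suc n} {v} {t} t∈I v∈I = ≤-trans
    (*-monoˡ-≤ (proj₁ (1-unit (*-unit t∈I (v∈I zero)))) (complements-chord t∈I (v∈I ∘ suc)))
    (≤-by (*-nonNeg (*-nonNeg (proj₁ t∈I) (proj₁ (v∈I zero)))
                    (*-nonNeg (proj₁ (1-unit t∈I)) (proj₁ (1-unit (complements-unit (v∈I ∘ suc))))))
      (solve 3 (λ t x p → con (+ 1) :- t :+ t :* ((con (+ 1) :- x) :* p) :=
                (con (+ 1) :- t :* x) :* (con (+ 1) :- t :+ t :* p) :+
                t :* x :* ((con (+ 1) :- t) :* (con (+ 1) :- p)))
             refl t (v zero) (complements (v ∘ suc))))

  -- The Weierstrass inequality gives the bound by `b * sum v`; nonnegativity of the product gives
  -- the bound by `b`.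
  ⊓-lower-bound : ∀ {n} {b} {v : Fin n → Carrier} → 0# ≤ b → (∀ j → UnitInterval (v j)) →
                  b * (1# - complements v) ≤ b * sum v ⊓ b
  ⊓-lower-bound {b = b} {v} 0≤b v∈I = ⊓-glb
    (*-monoˡ-≤ 0≤b (≤-by (x≤y⇒0≤y-x (1-sum≤complements v∈I))
      (solve 2 (λ s p → s := con (+ 1) :- p :+ (p :- (con (+ 1) :- s))) refl (sum v) (complements v))))
    (x*y≤x 0≤b (1-x≤1 (proj₁ (complements-unit v∈I))))

-- Truncated exponential series and the constant 1 - 1/e.

module Exponential {c ℓ} (R : CompleteOrderedField c ℓ) where
  open CompleteOrderedField R hiding (zero)
  open Euler R
  open OrderedField R
  open IntegerSolver commutativeRing using (solve; _:=_; _:+_; _:*_; _:-_; con)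
  open SemiringSum semiring using (*-distribʳ-sum)
  open SemiringExp semiring using (_^_)
  open SemiringMult semiring using (×1-homo-*)
  open import Relation.Binary.Reasoning.PartialOrder (TotalOrder.poset totalOrder)

  ^-nonNeg : ∀ {x} → 0# ≤ x → ∀ k → 0# ≤ x ^ k
  ^-nonNeg 0≤x zero    = 0≤1
  ^-nonNeg 0≤x (suc k) = *-nonNeg 0≤x (^-nonNeg 0≤x k)

  ^-mono-≤ : ∀ {x y} → 0# ≤ y → y ≤ x → ∀ k → y ^ k ≤ x ^ k
  ^-mono-≤ 0≤y y≤x zero    = ≤-refl
  ^-mono-≤ 0≤y y≤x (suc k) = ≤-trans (*-monoˡ-≤ 0≤y (^-mono-≤ 0≤y y≤x k))
                                     (*-monoʳ-≤ (^-nonNeg (≤-trans 0≤y y≤x) k) y≤x)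

  1^k≈1 : ∀ {x} → x ≈ 1# → ∀ k → x ^ k ≈ 1#
  1^k≈1 x≈1 zero    = refl
  1^k≈1 x≈1 (suc k) = trans (*-cong x≈1 (1^k≈1 x≈1 k)) (*-identityˡ 1#)

  -- Mean value inequality for powers: the derivative is increasing, so its value at the upper end
  -- `x` bounds the slope.
  ^-difference : ∀ {x y} → 0# ≤ y → y ≤ x → ∀ k →
                 x ^ suc k ≤ y ^ suc k + (suc k ×ℕ 1#) * ((x - y) * x ^ k)
  ^-difference {x} {y} 0≤y y≤x zero = ≤-reflexive
    (solve 2 (λ x y → x :* con (+ 1) := y :* con (+ 1) :+
               (con (+ 1) :+ con (+ 0)) :* ((x :- y) :* con (+ 1))) refl x y)
  ^-difference {x} {y} 0≤y y≤x (suc k) = ≤-by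
    (+-nonNeg (*-nonNeg (≤-trans 0≤y y≤x) (x≤y⇒0≤y-x (^-difference 0≤y y≤x k)))
              (*-nonNeg (x≤y⇒0≤y-x y≤x) (x≤y⇒0≤y-x (^-mono-≤ 0≤y y≤x (suc k)))))
    (solve 5 (λ x y a b c →
        y :* b :+ (con (+ 1) :+ c) :* ((x :- y) :* (x :* a)) :=
        x :* (x :* a) :+ (x :* (b :+ c :* ((x :- y) :* a) :- x :* a) :+ (x :- y) :* (x :* a :- b)))
      refl x y (x ^ k) (y ^ suc k) (suc k ×ℕ 1#))

  0≤×1 : ∀ n → 0# ≤ n ×ℕ 1#
  0≤×1 zero    = ≤-refl
  0≤×1 (suc n) = +-nonNeg 0≤1 (0≤×1 n)

  suc×1≉0 : ∀ n → ¬ (suc n ×ℕ 1# ≈ 0#)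
  suc×1≉0 n 1+n≈0 = 0≉1 (antisym 0≤1 (≤-trans (≤-by (0≤×1 n) refl) (≤-reflexive 1+n≈0)))

  !×1-suc : ∀ k → (suc k !) ×ℕ 1# ≈ (suc k ×ℕ 1#) * ((k !) ×ℕ 1#)
  !×1-suc k = ×1-homo-* (suc k) (k !)

  !×1≉0 : ∀ k → ¬ ((k !) ×ℕ 1# ≈ 0#)
  !×1≉0 k eq with k ! | ℕₚ.1≤n! k
  ... | suc f | _ = suc×1≉0 f eq

  0≤invFactorial : ∀ k → 0# ≤ invFactorial k
  0≤invFactorial k = ⁻¹-nonNeg (0≤×1 (k !)) (!×1≉0 k)

  invFactorial-0 : invFactorial 0 ≈ 1#
  invFactorial-0 = begin-equality
    invFactorial 0              ≈⟨ *-identityˡ _ ⟨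
    1# * invFactorial 0         ≈⟨ *-congʳ (+-identityʳ 1#) ⟨
    (1# + 0#) * invFactorial 0  ≈⟨ ⁻¹-inverseʳ (!×1≉0 0) ⟩
    1#                          ∎

  invFactorial-suc : ∀ k → (suc k ×ℕ 1#) * invFactorial (suc k) ≈ invFactorial k
  invFactorial-suc k = begin-equality
    a * invFactorial (suc k)                         ≈⟨ *-identityʳ _ ⟨
    a * invFactorial (suc k) * 1#                    ≈⟨ *-congˡ (⁻¹-inverseʳ (!×1≉0 k)) ⟨
    a * invFactorial (suc k) * (f * invFactorial k)  ≈⟨ solve 4 (λ a i f j → a :* i :* (f :* j) := a :* f :* i :* j)
                                                          refl a (invFactorial (suc k)) f (invFactorial k) ⟩
    a * f * invFactorial (suc k) * invFactorial k    ≈⟨ *-congʳ (*-congʳ (!×1-suc k)) ⟨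
    (suc k !) ×ℕ 1# * invFactorial (suc k) * invFactorial k ≈⟨ *-congʳ (⁻¹-inverseʳ (!×1≉0 (suc k))) ⟩
    1# * invFactorial k                              ≈⟨ *-identityˡ _ ⟩
    invFactorial k                                   ∎
    where
    a = suc k ×ℕ 1#
    f = (k !) ×ℕ 1#

  -- The first `k` terms of the exponential series; at 1 these are the partial sums whose supremum
  -- is `e`.
  expSum : Carrier → ℕ → Carrier
  expSum x zero    = 0#
  expSum x (suc k) = expSum x k + x ^ k * invFactorial k

  expSum-at-1 : ∀ {x} → x ≈ 1# → ∀ k → expSum x k ≈ partialSum k
  expSum-at-1 x≈1 zero    = refl
  expSum-at-1 x≈1 (suc k) = +-cong (expSum-at-1 x≈1 k) (trans (*-congʳ (1^k≈1 x≈1 k)) (*-identityˡ _))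

  expSum-at-0 : ∀ k → expSum 0# (suc k) ≈ 1#
  expSum-at-0 zero    = trans (+-identityˡ _) (trans (*-identityˡ _) invFactorial-0)
  expSum-at-0 (suc k) = trans (+-cong (expSum-at-0 k) (trans (*-congʳ (zeroˡ _)) (zeroˡ _))) (+-identityʳ 1#)

  expSum-nonNeg : ∀ {x} → 0# ≤ x → ∀ k → 0# ≤ expSum x k
  expSum-nonNeg 0≤x zero    = ≤-refl
  expSum-nonNeg 0≤x (suc k) = +-nonNeg (expSum-nonNeg 0≤x k) (*-nonNeg (^-nonNeg 0≤x k) (0≤invFactorial k))

  -- Mean value inequality again: the derivative of the truncation with `suc k` terms is the one
  -- with `k` terms, hence the shift of index on the right.
  expSum-difference : ∀ {x y} → 0# ≤ y → y ≤ x → ∀ k →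
                      expSum x (suc k) ≤ expSum y (suc k) + (x - y) * expSum x k
  expSum-difference {x} {y} 0≤y y≤x zero =
    ≤-reflexive (sym (trans (+-congˡ (zeroʳ _)) (+-identityʳ _)))
  expSum-difference {x} {y} 0≤y y≤x (suc k) = begin
    expSum x (suc k) + x ^ suc k * i
      ≤⟨ +-mono-≤ (expSum-difference 0≤y y≤x k) (*-monoʳ-≤ (0≤invFactorial (suc k)) (^-difference 0≤y y≤x k)) ⟩
    E + (x - y) * F + (b + n * ((x - y) * a)) * i
      ≈⟨ solve 7 (λ E d F b n a i → E :+ d :* F :+ (b :+ n :* (d :* a)) :* i :=
                                    E :+ b :* i :+ d :* (F :+ a :* (n :* i))) refl E (x - y) F b n a i ⟩
    E + b * i + (x - y) * (F + a * (n * i))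
      ≈⟨ +-congˡ (*-congˡ (+-congˡ (*-congˡ (invFactorial-suc k)))) ⟩
    E + b * i + (x - y) * (F + a * invFactorial k)  ∎
    where
    i = invFactorial (suc k)
    E = expSum y (suc k)
    F = expSum x k
    a = x ^ k
    b = y ^ suc k
    n = suc k ×ℕ 1#

  -- The truncated form of `(1 - w) exp (w + s) ≤ exp s`. Subtracting `w` times the full truncation,
  -- where `expSum-difference` subtracts `w` times the one with a term less, only helps, as the last
  -- term is nonnegative.
  expSum-shift : ∀ {s w} → 0# ≤ s → 0# ≤ w → ∀ k → (1# - w) * expSum (w + s) (suc k) ≤ expSum s (suc k)
  expSum-shift {s} {w} 0≤s 0≤w k = ≤-by
    (+-nonNeg (x≤y⇒0≤y-x (expSum-difference 0≤s (≤-by 0≤w (+-comm w s)) k))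
              (*-nonNeg 0≤w (*-nonNeg (^-nonNeg 0≤w+s k) (0≤invFactorial k))))
    (solve 5 (λ s w E F G → E := (con (+ 1) :- w) :* (F :+ G) :+
        ((E :+ (w :+ s :- s) :* F :- (F :+ G)) :+ w :* G))
      refl s w (expSum s (suc k)) (expSum (w + s) k) ((w + s) ^ k * invFactorial k))
    where 0≤w+s = +-nonNeg 0≤w 0≤s

  -- The truncated form of `∏ (1 - vⱼ) ≤ exp (- Σ vⱼ)`. Each factor is spent on removing its own
  -- `vⱼ` from the argument, until `expSum 0#` remains; that equals 1 only if the constant term is
  -- present, hence `suc k`.
  complements-expSum : ∀ {n} {v : Fin n → Carrier} → (∀ j → UnitInterval (v j)) →
                       ∀ k → complements v * expSum (sum v) (suc k) ≤ 1#
  complements-expSum {zero}  v∈I k = ≤-reflexive (trans (*-identityˡ _) (expSum-at-0 k))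
  complements-expSum {suc n} {v} v∈I k = begin
    (1# - v zero) * p * expSum (v zero + s) (suc k)
      ≈⟨ solve 3 (λ x p e → x :* p :* e := p :* (x :* e)) refl (1# - v zero) p _ ⟩
    p * ((1# - v zero) * expSum (v zero + s) (suc k))
      ≤⟨ *-monoˡ-≤ (proj₁ (complements-unit (v∈I ∘ suc)))
                   (expSum-shift (sum-nonNeg (proj₁ ∘ v∈I ∘ suc)) (proj₁ (v∈I zero)) k) ⟩
    p * expSum s (suc k)  ≤⟨ complements-expSum (v∈I ∘ suc) k ⟩
    1#                    ∎
    where
    p = complements (v ∘ suc)
    s = sum (v ∘ suc)

  1≤e : 1# ≤ e
  1≤e = ≤-trans (≤-reflexive (sym (trans (+-identityˡ _) invFactorial-0))) (proj₁ (proj₂ e-supremum) (1 , refl))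

  0≤e : 0# ≤ e
  0≤e = ≤-trans 0≤1 1≤e

  e≉0 : ¬ (e ≈ 0#)
  e≉0 e≈0 = 0≉1 (antisym 0≤1 (≤-trans 1≤e (≤-reflexive e≈0)))

  e⁻¹-unit : UnitInterval (e ⁻¹)
  e⁻¹-unit = ⁻¹-nonNeg 0≤e e≉0 , (begin
    e ⁻¹       ≈⟨ *-identityˡ _ ⟨
    1# * e ⁻¹  ≤⟨ /-≤1 0≤e e≉0 1≤e ⟩
    1#         ∎)

  -- For nonzero `p`, the inverse of `p` bounds all partial sums, and `e` is their least upper
  -- bound.
  partialSum-bound⇒≤e⁻¹ : ∀ {p} → 0# ≤ p → (∀ k → p * partialSum (suc k) ≤ 1#) → p ≤ e ⁻¹
  partialSum-bound⇒≤e⁻¹ {p} 0≤p bound with p ≟ 0#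
  ... | yes p≈0 = ≤-trans (≤-reflexive p≈0) (proj₁ e⁻¹-unit)
  ... | no  p≉0 = begin
    p             ≈⟨ *-identityʳ p ⟨
    p * 1#        ≈⟨ *-congˡ (⁻¹-inverseʳ e≉0) ⟨
    p * (e / e)   ≈⟨ *-assoc p e (e ⁻¹) ⟨
    p * e / e     ≤⟨ *-monoʳ-≤ (proj₁ e⁻¹-unit) pe≤1 ⟩
    1# / e        ≈⟨ *-identityˡ _ ⟩
    e ⁻¹          ∎
    where
    partialSum≤ : ∀ k → partialSum k ≤ p ⁻¹
    partialSum≤ zero    = ⁻¹-nonNeg 0≤p p≉0
    partialSum≤ (suc k) = begin
      S               ≈⟨ /-*-cancel S p≉0 ⟨
      S / p * p       ≈⟨ solve 3 (λ s i p → s :* i :* p := p :* s :* i) refl S (p ⁻¹) p ⟩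
      p * S * p ⁻¹    ≤⟨ *-monoʳ-≤ (⁻¹-nonNeg 0≤p p≉0) (bound k) ⟩
      1# * p ⁻¹       ≈⟨ *-identityˡ _ ⟩
      p ⁻¹            ∎
      where S = partialSum (suc k)
    pe≤1 : p * e ≤ 1#
    pe≤1 = begin
      p * e     ≤⟨ *-monoˡ-≤ 0≤p (proj₂ (proj₂ e-supremum)
                     λ (k , x≈) → ≤-trans (≤-reflexive x≈) (partialSum≤ k)) ⟩
      p * p ⁻¹  ≈⟨ ⁻¹-inverseʳ p≉0 ⟩
      1#        ∎

  complements≤e⁻¹ : ∀ {n} {v : Fin n → Carrier} → (∀ j → UnitInterval (v j)) →
                    sum v ≈ 1# → complements v ≤ e ⁻¹
  complements≤e⁻¹ {v = v} v∈I Σv≈1 = partialSum-bound⇒≤e⁻¹ (proj₁ (complements-unit v∈I)) λ k → begin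
    complements v * partialSum (suc k)      ≈⟨ *-congˡ (expSum-at-1 Σv≈1 (suc k)) ⟨
    complements v * expSum (sum v) (suc k)  ≤⟨ complements-expSum v∈I k ⟩
    1#                                      ∎

  -- Rescale w to total weight 1 and move back along the chord.
  complements-bound : ∀ {n} {w : Fin n → Carrier} → (∀ j → UnitInterval (w j)) → sum w ≤ 1# →
                      (1# - e ⁻¹) * sum w ≤ 1# - complements w
  complements-bound {w = w} w∈I s≤1 with sum w ≟ 0#
  ... | yes s≈0 = begin
    (1# - e ⁻¹) * sum w  ≈⟨ *-congˡ s≈0 ⟩
    (1# - e ⁻¹) * 0#     ≈⟨ zeroʳ _ ⟩
    0#                   ≤⟨ proj₁ (1-unit (complements-unit w∈I)) ⟩
    1# - complements w   ∎
  ... | no s≉0 = begin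
    (1# - e ⁻¹) * s                ≈⟨ solve 2 (λ x s → (con (+ 1) :- x) :* s := con (+ 1) :- (con (+ 1) :- s :+ s :* x))
                                        refl (e ⁻¹) s ⟩
    1# - (1# - s + s * e ⁻¹)       ≤⟨ 1-mono-≥ (+-monoʳ-≤ _ (*-monoˡ-≤ 0≤s (complements≤e⁻¹ v∈I Σv≈1))) ⟩
    1# - (1# - s + s * complements v)  ≤⟨ 1-mono-≥ (complements-chord (0≤s , s≤1) v∈I) ⟩
    1# - complements (λ j → s * v j)   ≈⟨ 1-cong (complements-cong λ j → trans (*-comm s (v j)) (/-*-cancel (w j) s≉0)) ⟩
    1# - complements w                 ∎
    where
    s = sum w
    v = λ j → w j / s
    0≤s = sum-nonNeg (proj₁ ∘ w∈I)
    v∈I : ∀ j → UnitInterval (v j)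
    v∈I j = *-nonNeg (proj₁ (w∈I j)) (⁻¹-nonNeg 0≤s s≉0) , /-≤1 0≤s s≉0 (term≤sum (proj₁ ∘ w∈I) j)
    Σv≈1 : sum v ≈ 1#
    Σv≈1 = trans (sym (*-distribʳ-sum (s ⁻¹) w)) (⁻¹-inverseʳ s≉0)

  -- A positive budget can be cancelled from the constraint to give `sum w ≤ 1#`; a zero budget
  -- makes both sides vanish.
  scaled-complements-bound : ∀ {n} {b} {w : Fin n → Carrier} → 0# ≤ b → (∀ j → UnitInterval (w j)) →
                             b * sum w ≤ b → (1# - e ⁻¹) * (b * sum w) ≤ b * (1# - complements w)
  scaled-complements-bound {b = b} {w} 0≤b w∈I bs≤b with b ≟ 0#
  ... | yes b≈0 = ≤-reflexive (begin-equality
    (1# - e ⁻¹) * (b * sum w)  ≈⟨ *-congˡ (trans (*-congʳ b≈0) (zeroˡ _)) ⟩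
    (1# - e ⁻¹) * 0#           ≈⟨ zeroʳ _ ⟩
    0#                         ≈⟨ zeroˡ _ ⟨
    0# * (1# - complements w)  ≈⟨ *-congʳ b≈0 ⟨
    b * (1# - complements w)   ∎)
  ... | no b≉0 = begin
    (1# - e ⁻¹) * (b * sum w)  ≈⟨ solve 3 (λ a b s → a :* (b :* s) := b :* (a :* s)) refl (1# - e ⁻¹) b (sum w) ⟩
    b * ((1# - e ⁻¹) * sum w)  ≤⟨ *-monoˡ-≤ 0≤b (complements-bound w∈I (*-cancelˡ-≤1 0≤b b≉0 bs≤b)) ⟩
    b * (1# - complements w)   ∎

-- Decisions and 0/1 indicators.

does-∈? : ∀ {n} (j : Fin n) (S : Subset n) → does (j ∈? S) ≡ lookup S j
does-∈? zero    (inside  ∷ S) = ≡.refl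
does-∈? zero    (outside ∷ S) = ≡.refl
does-∈? (suc j) (_ ∷ S)       = does-∈? j S

does-all?-cong : ∀ {k p q} {P : Pred (Fin k) p} {Q : Pred (Fin k) q}
                 (P? : Decidable P) (Q? : Decidable Q) →
                 (∀ j → does (P? j) ≡ does (Q? j)) → does (all? P?) ≡ does (all? Q?)
does-all?-cong {zero}  P? Q? P≡Q = ≡.refl
does-all?-cong {suc k} P? Q? P≡Q = ≡.cong₂ _∧_ (P≡Q zero) (does-all?-cong (P? ∘ suc) (Q? ∘ suc) (P≡Q ∘ suc))

module Indicators {c ℓ} (R : CompleteOrderedField c ℓ) where
  open CompleteOrderedField R hiding (zero)
  open OrderedField R
  open Probability R using (indicator)
  open CommutativeMonoidSum +-commutativeMonoid using ()
    renaming (sum-cong-≋ to sum-cong; sum-replicate-zero to sum-zero)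
  open CommutativeMonoidSum *-commutativeMonoid using ()
    renaming (sum-cong-≋ to product-cong; sum-replicate-zero to product-one)
  open import Relation.Binary.Reasoning.PartialOrder (TotalOrder.poset totalOrder)

  indicator-unit : ∀ b → UnitInterval (indicator b)
  indicator-unit true  = 0≤1 , ≤-refl
  indicator-unit false = ≤-refl , 0≤1

  indicator-∧ : ∀ a b → indicator (a ∧ b) ≈ indicator a * indicator b
  indicator-∧ true  b = sym (*-identityˡ _)
  indicator-∧ false b = sym (zeroˡ _)

  indicator-not : ∀ b → indicator (not b) ≈ 1# - indicator b
  indicator-not true  = sym (-‿inverseʳ 1#)
  indicator-not false = sym 1-0≈1

  indicator-nand : ∀ a b → indicator (not (a ∧ b)) ≈ 1# - indicator a * indicator b
  indicator-nand a b = trans (indicator-not (a ∧ b)) (1-cong (indicator-∧ a b))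

  indicator-all? : ∀ {k p} {P : Pred (Fin k) p} (P? : Decidable P) →
                   indicator (does (all? P?)) ≈ product (indicator ∘ does ∘ P?)
  indicator-all? {zero}  P? = refl
  indicator-all? {suc k} P? = trans (indicator-∧ (does (P? zero)) _) (*-congˡ (indicator-all? (P? ∘ suc)))

  indicator-≟0 : ∀ b → does (indicator b ≟ 0#) ≡ not b
  indicator-≟0 true  = dec-false (1# ≟ 0#) (0≉1 ∘ sym)
  indicator-≟0 false = dec-true (0# ≟ 0#) refl

  indicator-≟1 : ∀ b → does (indicator b ≟ 1#) ≡ b
  indicator-≟1 true  = dec-true (1# ≟ 1#) refl
  indicator-≟1 false = dec-false (0# ≟ 1#) 0≉1

  indicator-≤?0 : ∀ b → does (indicator b ≤? 0#) ≡ not b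
  indicator-≤?0 true  = dec-false (1# ≤? 0#) (λ 1≤0 → 0≉1 (antisym 0≤1 1≤0))
  indicator-≤?0 false = dec-true (0# ≤? 0#) ≤-refl

  sum-δ : ∀ {n} (f : Fin n → Carrier) i → sum (λ k → f k * indicator (does (k ≟F i))) ≈ f i
  sum-δ {suc n} f zero = begin-equality
    f zero * 1# + sum (λ k → f (suc k) * 0#)
      ≈⟨ +-cong (*-identityʳ _) (trans (sum-cong (λ k → zeroʳ (f (suc k)))) (sum-zero n)) ⟩
    f zero + 0#  ≈⟨ +-identityʳ _ ⟩
    f zero       ∎
  sum-δ {suc n} f (suc i) = begin-equality
    f zero * 0# + sum (λ k → f (suc k) * indicator (does (k ≟F i)))  ≈⟨ +-cong (zeroʳ _) (sum-δ (f ∘ suc) i) ⟩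
    0# + f (suc i)                                                   ≈⟨ +-identityˡ _ ⟩
    f (suc i)                                                        ∎

  -- Only the factor at `g = h` differs from 1. Read from right to left, this spreads the factor of
  -- one query over all slots.
  complements-δ : ∀ {n} x (h : Fin n) → complements (λ g → x * indicator (does (h ≟F g))) ≈ 1# - x
  complements-δ {suc n} x zero = begin-equality
    (1# - x * 1#) * complements {n} (λ _ → x * 0#)  ≈⟨ *-cong (1-cong (*-identityʳ x))
         (trans (product-cong {n} (λ _ → trans (1-cong (zeroʳ x)) 1-0≈1)) (product-one n)) ⟩
    (1# - x) * 1#                                ≈⟨ *-identityʳ _ ⟩
    1# - x                                       ∎
  complements-δ {suc n} x (suc h) = begin-equality
    (1# - x * 0#) * complements (λ g → x * indicator (does (h ≟F g)))
      ≈⟨ *-cong (trans (1-cong (zeroʳ x)) 1-0≈1) (complements-δ x h) ⟩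
    1# * (1# - x)  ≈⟨ *-identityˡ _ ⟩
    1# - x         ∎

-- Finite expectations and dependence of arrivals.

module Expectation {c ℓ} (R : CompleteOrderedField c ℓ)
                   (space : Probability.FiniteProbabilitySpace R) where
  open CompleteOrderedField R hiding (zero)
  open OrderedField R
  open Indicators R
  open Probability R using (indicator)
  open Probability.FiniteProbabilitySpace space
  open IntegerSolver commutativeRing using (solve; _:=_; _:+_; _:*_; _:-_; :-_; con)
  open SemiringSum semiring using (sum-replicate-zero; ∑-distrib-+; ∑-comm; *-distribˡ-sum; *-distribʳ-sum)
    renaming (sum-cong-≋ to sum-cong)
  open import Relation.Binary.Reasoning.PartialOrder (TotalOrder.poset totalOrder)

  𝔼-cong : ∀ {X Y : Ω → Carrier} → (∀ ω → X ω ≈ Y ω) → 𝔼 X ≈ 𝔼 Y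
  𝔼-cong X≈Y = sum-cong (*-congˡ ∘ X≈Y)

  𝔼-mono-≤ : ∀ {X Y : Ω → Carrier} → (∀ ω → X ω ≤ Y ω) → 𝔼 X ≤ 𝔼 Y
  𝔼-mono-≤ X≤Y = sum-mono-≤ λ ω → *-monoˡ-≤ (mass-nonNeg ω) (X≤Y ω)

  𝔼-nonNeg : ∀ {X : Ω → Carrier} → (∀ ω → 0# ≤ X ω) → 0# ≤ 𝔼 X
  𝔼-nonNeg 0≤X = sum-nonNeg λ ω → *-nonNeg (mass-nonNeg ω) (0≤X ω)

  𝔼-const : ∀ a → 𝔼 (const a) ≈ a
  𝔼-const a = trans (sym (*-distribʳ-sum a mass)) (trans (*-congʳ mass-total) (*-identityˡ a))

  𝔼-+ : ∀ (X Y : Ω → Carrier) → 𝔼 (λ ω → X ω + Y ω) ≈ 𝔼 X + 𝔼 Y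
  𝔼-+ X Y = trans (sum-cong λ ω → distribˡ (mass ω) (X ω) (Y ω))
                  (∑-distrib-+ (λ ω → mass ω * X ω) (λ ω → mass ω * Y ω))

  𝔼-*ˡ : ∀ a (X : Ω → Carrier) → 𝔼 (λ ω → a * X ω) ≈ a * 𝔼 X
  𝔼-*ˡ a X = trans (sum-cong λ ω → solve 3 (λ m a x → m :* (a :* x) := a :* (m :* x)) refl (mass ω) a (X ω))
                   (sym (*-distribˡ-sum a (λ ω → mass ω * X ω)))

  𝔼-*ʳ : ∀ (X : Ω → Carrier) a → 𝔼 (λ ω → X ω * a) ≈ 𝔼 X * a
  𝔼-*ʳ X a = trans (𝔼-cong λ ω → *-comm (X ω) a) (trans (𝔼-*ˡ a X) (*-comm a (𝔼 X)))

  𝔼-- : ∀ (X Y : Ω → Carrier) → 𝔼 (λ ω → X ω - Y ω) ≈ 𝔼 X - 𝔼 Y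
  𝔼-- X Y = begin-equality
    𝔼 (λ ω → X ω - Y ω)           ≈⟨ 𝔼-cong (λ ω → solve 2 (λ x y → x :- y := x :+ (:- con (+ 1)) :* y) refl (X ω) (Y ω)) ⟩
    𝔼 (λ ω → X ω + - 1# * Y ω)    ≈⟨ 𝔼-+ X _ ⟩
    𝔼 X + 𝔼 (λ ω → - 1# * Y ω)    ≈⟨ +-congˡ (𝔼-*ˡ (- 1#) Y) ⟩
    𝔼 X + - 1# * 𝔼 Y              ≈⟨ solve 2 (λ x y → x :+ (:- con (+ 1)) :* y := x :- y) refl (𝔼 X) (𝔼 Y) ⟩
    𝔼 X - 𝔼 Y                     ∎

  𝔼-sum : ∀ {n} (X : Fin n → Ω → Carrier) → 𝔼 (λ ω → sum (λ j → X j ω)) ≈ sum (λ j → 𝔼 (X j))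
  𝔼-sum X = trans (sum-cong λ ω → *-distribˡ-sum (mass ω) (λ j → X j ω))
                  (∑-comm (λ ω j → mass ω * X j ω))

  𝔼-≤1 : ∀ {X : Ω → Carrier} → (∀ ω → X ω ≤ 1#) → 𝔼 X ≤ 1#
  𝔼-≤1 X≤1 = ≤-trans (𝔼-mono-≤ X≤1) (≤-reflexive (𝔼-const 1#))

  𝔼-unit : ∀ {X : Ω → Carrier} → (∀ ω → UnitInterval (X ω)) → UnitInterval (𝔼 X)
  𝔼-unit X∈I = 𝔼-nonNeg (proj₁ ∘ X∈I) , 𝔼-≤1 (proj₂ ∘ X∈I)

  -- Both sides are affine in each zⱼ, so it suffices to compare them at the
  -- vertices of the cube; W and C accumulate the coordinates already treated.
  vertices⇒cube : ∀ {k} (W : Ω → Carrier) (C : Carrier) (X : Fin k → Ω → Carrier) (p : Fin k → Carrier) →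
    (∀ (b : Fin k → Bool) → 𝔼 (λ ω → W ω * complements (λ j → indicator (b j) * X j ω)) ≤
           C * complements (λ j → indicator (b j) * p j)) →
    ∀ {z : Fin k → Carrier} → (∀ j → UnitInterval (z j)) →
    𝔼 (λ ω → W ω * complements (λ j → z j * X j ω)) ≤ C * complements (λ j → z j * p j)
  vertices⇒cube {zero}  W C X p vertices z∈I = vertices λ ()
  vertices⇒cube {suc k} W C X p vertices {z} z∈I = begin
    𝔼 (λ ω → W ω * ((1# - z₀ * X zero ω) * complements (λ j → z (suc j) * X (suc j) ω)))
      ≈⟨ 𝔼-cong (λ ω → *-assoc (W ω) _ _) ⟨
    𝔼 (λ ω → W ω * (1# - z₀ * X zero ω) * complements (λ j → z (suc j) * X (suc j) ω))
      ≤⟨ vertices⇒cube (λ ω → W ω * (1# - z₀ * X zero ω)) (C * (1# - z₀ * p zero)) (X ∘ suc) (p ∘ suc)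
           edge (z∈I ∘ suc) ⟩
    C * (1# - z₀ * p zero) * complements (λ j → z (suc j) * p (suc j))
      ≈⟨ *-assoc C _ _ ⟩
    C * ((1# - z₀ * p zero) * complements (λ j → z (suc j) * p (suc j)))  ∎
    where
    z₀ = z zero
    -- An affine function of `z₀` is the weighted mean of its values at 0 and 1. The same identity
    -- is applied under the expectation and to the bound.
    split : ∀ w x q → w * (1# - z₀ * x) * q ≈
                      (1# - z₀) * (w * ((1# - 0# * x) * q)) + z₀ * (w * ((1# - 1# * x) * q))
    split w x q = solve 4 (λ z w x q → w :* (con (+ 1) :- z :* x) :* q :=
        (con (+ 1) :- z) :* (w :* ((con (+ 1) :- con (+ 0) :* x) :* q)) :+
        z :* (w :* ((con (+ 1) :- con (+ 1) :* x) :* q))) refl z₀ w x q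
    edge : ∀ (b : Fin k → Bool) → 𝔼 (λ ω → W ω * (1# - z₀ * X zero ω) * complements (λ j → indicator (b j) * X (suc j) ω)) ≤
                 C * (1# - z₀ * p zero) * complements (λ j → indicator (b j) * p (suc j))
    edge b = begin
      𝔼 (λ ω → W ω * (1# - z₀ * X zero ω) * Q ω)
        ≈⟨ 𝔼-cong (λ ω → split (W ω) (X zero ω) (Q ω)) ⟩
      𝔼 (λ ω → (1# - z₀) * (W ω * ((1# - 0# * X zero ω) * Q ω)) + z₀ * (W ω * ((1# - 1# * X zero ω) * Q ω)))
        ≈⟨ trans (𝔼-+ _ _) (+-cong (𝔼-*ˡ _ _) (𝔼-*ˡ _ _)) ⟩
      (1# - z₀) * 𝔼 (λ ω → W ω * ((1# - 0# * X zero ω) * Q ω)) + z₀ * 𝔼 (λ ω → W ω * ((1# - 1# * X zero ω) * Q ω))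
        ≤⟨ +-mono-≤ (*-monoˡ-≤ (proj₁ (1-unit (z∈I zero))) (facet false))
                    (*-monoˡ-≤ (proj₁ (z∈I zero)) (facet true)) ⟩
      (1# - z₀) * (C * ((1# - 0# * p zero) * q)) + z₀ * (C * ((1# - 1# * p zero) * q))
        ≈⟨ split C (p zero) q ⟨
      C * (1# - z₀ * p zero) * q  ∎
      where
      Q = λ ω → complements (λ j → indicator (b j) * X (suc j) ω)
      q = complements (λ j → indicator (b j) * p (suc j))
      facet : ∀ b₀ → 𝔼 (λ ω → W ω * ((1# - indicator b₀ * X zero ω) * Q ω)) ≤ C * ((1# - indicator b₀ * p zero) * q)
      facet b₀ = vertices (b₀ Vector.∷ b)

  -- For 0/1 variables this is negative lower orthant dependence at level 0, with `b` the
  -- characteristic function of the set T.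
  LowerOrthantDependent : ∀ {k} → (Fin k → Ω → Carrier) → Set ℓ
  LowerOrthantDependent {k} X = ∀ (b : Fin k → Bool) → 𝔼 (λ ω → complements (λ j → indicator (b j) * X j ω)) ≤
                                  complements (λ j → indicator (b j) * 𝔼 (X j))

  𝔼-complements-≤ : ∀ {k} {X : Fin k → Ω → Carrier} → LowerOrthantDependent X →
                    ∀ {z : Fin k → Carrier} → (∀ j → UnitInterval (z j)) →
                    𝔼 (λ ω → complements (λ j → z j * X j ω)) ≤ complements (λ j → z j * 𝔼 (X j))
  𝔼-complements-≤ {X = X} lod {z} z∈I = begin
    𝔼 (λ ω → complements (λ j → z j * X j ω))        ≈⟨ 𝔼-cong (λ ω → *-identityˡ _) ⟨
    𝔼 (λ ω → 1# * complements (λ j → z j * X j ω))   ≤⟨ vertices⇒cube (const 1#) 1# X (𝔼 ∘ X) vertices z∈I ⟩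
    1# * complements (λ j → z j * 𝔼 (X j))           ≈⟨ *-identityˡ _ ⟩
    complements (λ j → z j * 𝔼 (X j))                ∎
    where
    vertices : ∀ (b : Fin _ → Bool) → 𝔼 (λ ω → 1# * complements (λ j → indicator (b j) * X j ω)) ≤
                     1# * complements (λ j → indicator (b j) * 𝔼 (X j))
    vertices b = begin
      𝔼 (λ ω → 1# * complements (λ j → indicator (b j) * X j ω)) ≈⟨ 𝔼-cong (λ ω → *-identityˡ _) ⟩
      𝔼 (λ ω → complements (λ j → indicator (b j) * X j ω))      ≤⟨ lod b ⟩
      complements (λ j → indicator (b j) * 𝔼 (X j))              ≈⟨ *-identityˡ _ ⟨
      1# * complements (λ j → indicator (b j) * 𝔼 (X j))         ∎

  -- In `(1# - X₀) * Q = Q - X₀ + X₀ * (1# - Q)` the last factor is at most the sum `S` of the other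
  -- variables, and `X₀ * S` has mean zero by exclusivity. Since the mean of `Q` is at most 1, what
  -- is left is at most `(1# - 𝔼 X₀) * 𝔼 Q`.
  exclusive-complements : ∀ {k} {X : Fin k → Ω → Carrier} → (∀ j ω → UnitInterval (X j ω)) →
    (∀ {j l} → j ≢ l → 𝔼 (λ ω → X j ω * X l ω) ≈ 0#) →
    𝔼 (λ ω → complements (λ j → X j ω)) ≤ complements (λ j → 𝔼 (X j))
  exclusive-complements {zero}  X∈I exclusive = ≤-reflexive (𝔼-const 1#)
  exclusive-complements {suc k} {X} X∈I exclusive = begin
    𝔼 (λ ω → (1# - X zero ω) * Q ω)
      ≤⟨ 𝔼-mono-≤ (λ ω → ≤-by
           (*-nonNeg (proj₁ (X∈I zero ω)) (x≤y⇒0≤y-x (1-sum≤complements (λ j → X∈I (suc j) ω))))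
           (solve 3 (λ x q s → q :- x :+ x :* s := (con (+ 1) :- x) :* q :+ x :* (q :- (con (+ 1) :- s)))
              refl (X zero ω) (Q ω) (S ω))) ⟩
    𝔼 (λ ω → Q ω - X zero ω + X zero ω * S ω)
      ≈⟨ trans (𝔼-+ _ _) (+-cong (𝔼-- Q (X zero)) cross≈0) ⟩
    𝔼 Q - x₀ + 0#
      ≤⟨ ≤-by (*-nonNeg (proj₁ x₀∈I) (proj₁ (1-unit Q∈I)))
           (solve 2 (λ x q → (con (+ 1) :- x) :* q := q :- x :+ con (+ 0) :+ x :* (con (+ 1) :- q)) refl x₀ (𝔼 Q)) ⟩
    (1# - x₀) * 𝔼 Q
      ≤⟨ *-monoˡ-≤ (proj₁ (1-unit x₀∈I))
           (exclusive-complements (X∈I ∘ suc) (λ j≢l → exclusive λ { ≡.refl → j≢l ≡.refl })) ⟩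
    (1# - x₀) * complements (λ j → 𝔼 (X (suc j)))  ∎
    where
    x₀ = 𝔼 (X zero)
    Q = λ ω → complements (λ j → X (suc j) ω)
    S = λ ω → sum (λ j → X (suc j) ω)
    x₀∈I = 𝔼-unit (X∈I zero)
    Q∈I = 𝔼-unit (λ ω → complements-unit (λ j → X∈I (suc j) ω))
    cross≈0 : 𝔼 (λ ω → X zero ω * S ω) ≈ 0#
    cross≈0 = begin-equality
      𝔼 (λ ω → X zero ω * S ω)                          ≈⟨ 𝔼-cong (λ ω → *-distribˡ-sum (X zero ω) (λ j → X (suc j) ω)) ⟩
      𝔼 (λ ω → sum (λ j → X zero ω * X (suc j) ω))      ≈⟨ 𝔼-sum (λ j ω → X zero ω * X (suc j) ω) ⟩
      sum (λ j → 𝔼 (λ ω → X zero ω * X (suc j) ω))      ≈⟨ sum-cong (λ j → exclusive {zero} {suc j} λ ()) ⟩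
      sum {k} (const 0#)                                ≈⟨ sum-replicate-zero k ⟩
      0#                                                ∎

-- Negative correlation bounds the probability of no arrival.

module NegativeCorrelation {c ℓ} (R : CompleteOrderedField c ℓ)
                           (space : Probability.FiniteProbabilitySpace R) where
  open CompleteOrderedField R hiding (zero)
  open OrderedField R
  open Indicators R
  open Expectation R space
  open Probability R using (indicator)
  open Probability.FiniteProbabilitySpace space
  open IntegerSolver commutativeRing using (solve; _:=_; _:+_; _:*_; _:-_)
  open CommutativeMonoidSum +-commutativeMonoid using (sum-cong-≗)
  open CommutativeMonoidSum *-commutativeMonoid using () renaming (sum-cong-≋ to product-cong)
  open import Relation.Binary.Reasoning.PartialOrder (TotalOrder.poset totalOrder)

  -- Events enter probabilities only through `does`; the equality is propositional so that strict
  -- inequalities and quotients can be transported along it.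
  ℙ-cong : ∀ {p q} {E : Pred Ω p} {F : Pred Ω q} (E? : Decidable E) (F? : Decidable F) →
           (∀ ω → does (E? ω) ≡ does (F? ω)) → ℙ E? ≡ ℙ F?
  ℙ-cong E? F? E≡F = sum-cong-≗ λ ω → ≡.cong (λ b → mass ω * indicator b) (E≡F ω)

  agreesOn-∷ : ∀ {k} (X : Fin (suc k) → Ω → Carrier) s (S : Subset k) x ω →
               does (agreesOn X (s ∷ S) x ω) ≡
               (not s ∨ does (X zero ω ≟ x zero)) ∧ does (agreesOn (X ∘ suc) S (x ∘ suc) ω)
  agreesOn-∷ X s S x ω = by-head s
    where
    rest : ∀ s → does (all? λ j → (suc j ∈? s ∷ S) →-dec (X (suc j) ω ≟ x (suc j))) ≡
                 does (agreesOn (X ∘ suc) S (x ∘ suc) ω)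
    rest s = does-all?-cong (λ j → (suc j ∈? s ∷ S) →-dec (X (suc j) ω ≟ x (suc j)))
                            (λ j → (j ∈? S) →-dec (X (suc j) ω ≟ x (suc j))) λ _ → ≡.refl
    by-head : ∀ s → does (agreesOn X (s ∷ S) x ω) ≡
                 (not s ∨ does (X zero ω ≟ x zero)) ∧ does (agreesOn (X ∘ suc) S (x ∘ suc) ω)
    by-head inside  = ≡.cong (does (X zero ω ≟ x zero) ∧_) (rest inside)
    by-head outside = rest outside

  -- Conditioning is confined to the tail while `i` ranges over all variables: `i = zero` gives the
  -- comparison for the head, and `suc i` passes the hypothesis to the tail.
  conditional-mono : ∀ {k} {X : Fin (suc k) → Ω → Carrier} → NegativelyCorrelated X →
    ∀ i (S : Subset k) → i ∉ outside ∷ S → ∀ a x x′ → (∀ j → j ∈ S → x j ≤ x′ j) →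
    0# < ℙ (agreesOn (X ∘ suc) S x) → 0# < ℙ (agreesOn (X ∘ suc) S x′) →
    ℙ[ (λ ω → X i ω ≤? a) ∣ agreesOn (X ∘ suc) S x ] ≤
    ℙ[ (λ ω → X i ω ≤? a) ∣ agreesOn (X ∘ suc) S x′ ]
  conditional-mono {X = X} nc i S i∉S a x x′ x≤x′ 0<α 0<α′ =
    ≡.subst₂ _≤_ (conditional x) (conditional x′)
      -- The head value `0#` is a filler, as `outside` excludes that coordinate from the event.
      (nc i (outside ∷ S) i∉S a (0# Vector.∷ x) (0# Vector.∷ x′)
        (λ { (suc j) j∈S → x≤x′ j (drop-there j∈S) })
        (≡.subst (0# <_) (≡.sym (condition x)) 0<α) (≡.subst (0# <_) (≡.sym (condition x′)) 0<α′))
    where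
    condition : ∀ x → ℙ (agreesOn X (outside ∷ S) (0# Vector.∷ x)) ≡ ℙ (agreesOn (X ∘ suc) S x)
    condition x = ℙ-cong (agreesOn X (outside ∷ S) (0# Vector.∷ x)) (agreesOn (X ∘ suc) S x)
      (agreesOn-∷ X outside S (0# Vector.∷ x))
    conditional : ∀ x → ℙ[ (λ ω → X i ω ≤? a) ∣ agreesOn X (outside ∷ S) (0# Vector.∷ x) ] ≡
                        ℙ[ (λ ω → X i ω ≤? a) ∣ agreesOn (X ∘ suc) S x ]
    conditional x = ≡.cong₂ _/_
      (ℙ-cong (λ ω → (X i ω ≤? a) ×-dec agreesOn X (outside ∷ S) (0# Vector.∷ x) ω)
              (λ ω → (X i ω ≤? a) ×-dec agreesOn (X ∘ suc) S x ω)
              λ ω → ≡.cong (does (X i ω ≤? a) ∧_) (agreesOn-∷ X outside S (0# Vector.∷ x) ω))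
      (condition x)

  negativelyCorrelated-tail : ∀ {k} {X : Fin (suc k) → Ω → Carrier} →
                              NegativelyCorrelated X → NegativelyCorrelated (X ∘ suc)
  negativelyCorrelated-tail nc i S i∉S = conditional-mono nc (suc i) S (i∉S ∘ drop-there)

  agrees : ∀ {k} → (Fin k → Ω → Carrier) → Subset k → (Fin k → Carrier) → Ω → Carrier
  agrees X S x ω = indicator (does (agreesOn X S x ω))

  agrees-unit : ∀ {k} (X : Fin k → Ω → Carrier) S x ω → UnitInterval (agrees X S x ω)
  agrees-unit X S x ω = indicator-unit (does (agreesOn X S x ω))

  agrees-at-0 : ∀ {k} (Z : Fin k → Ω → Bool) (b : Fin k → Bool) ω →
                agrees (λ j → indicator ∘ Z j) (tabulate b) (const 0#) ω ≈
                complements (λ j → indicator (b j) * indicator (Z j ω))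
  agrees-at-0 Z b ω = trans (indicator-all? λ j → (j ∈? tabulate b) →-dec (indicator (Z j ω) ≟ 0#)) (product-cong factor)
    where
    nand : ∀ x y → not x ∨ not y ≡ not (x ∧ y)
    nand true  y = ≡.refl
    nand false y = ≡.refl
    factor : ∀ j → indicator (not (does (j ∈? tabulate b)) ∨ does (indicator (Z j ω) ≟ 0#)) ≈
                   1# - indicator (b j) * indicator (Z j ω)
    factor j rewrite does-∈? j (tabulate b) | lookup∘tabulate b j | indicator-≟0 (Z j ω) =
      trans (reflexive (≡.cong indicator (nand (b j) (Z j ω)))) (indicator-nand (b j) (Z j ω))

  -- Law of total expectation: the cylinders over `S` partition the space. Each `inside` coordinate
  -- merges the cylinders for `true` and `false`; an `outside` coordinate takes `false` as a filler.
  nonNeg-on-cylinders : ∀ {k} (Z : Fin k → Ω → Bool) (S : Subset k) (h : Ω → Carrier) →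
    (∀ (b : Fin k → Bool) → 0# ≤ 𝔼 (λ ω → h ω * agrees (λ j → indicator ∘ Z j) S (indicator ∘ b) ω)) → 0# ≤ 𝔼 h
  nonNeg-on-cylinders Z [] h 0≤ = ≤-trans (0≤ λ ()) (≤-reflexive (𝔼-cong λ ω → *-identityʳ (h ω)))
  nonNeg-on-cylinders Z (outside ∷ S) h 0≤ =
    nonNeg-on-cylinders (Z ∘ suc) S h λ b → ≤-trans (0≤ (false Vector.∷ b))
      (≤-reflexive (𝔼-cong λ ω → *-congˡ (reflexive (≡.cong indicator
        (agreesOn-∷ (λ j → indicator ∘ Z j) outside S (indicator ∘ (false Vector.∷ b)) ω)))))
  nonNeg-on-cylinders Z (inside ∷ S) h 0≤ =
    nonNeg-on-cylinders (Z ∘ suc) S h λ b → begin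
      0#  ≤⟨ +-nonNeg (0≤ (true Vector.∷ b)) (0≤ (false Vector.∷ b)) ⟩
      𝔼 (λ ω → h ω * A b true ω) + 𝔼 (λ ω → h ω * A b false ω)
        ≈⟨ 𝔼-+ _ _ ⟨
      𝔼 (λ ω → h ω * A b true ω + h ω * A b false ω)
        ≈⟨ 𝔼-cong (λ ω → trans (sym (distribˡ (h ω) _ _)) (*-congˡ (split b ω))) ⟩
      𝔼 (λ ω → h ω * agrees (λ j → indicator ∘ Z (suc j)) S (indicator ∘ b) ω)  ∎
    where
    A : ∀ b z ω → Carrier
    A b z ω = agrees (λ j → indicator ∘ Z j) (inside ∷ S) (indicator ∘ (z Vector.∷ b)) ω
    split : ∀ b ω → A b true ω + A b false ω ≈ agrees (λ j → indicator ∘ Z (suc j)) S (indicator ∘ b) ω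
    split b ω rewrite agreesOn-∷ (λ j → indicator ∘ Z j) inside S (indicator ∘ (true Vector.∷ b)) ω
                    | agreesOn-∷ (λ j → indicator ∘ Z j) inside S (indicator ∘ (false Vector.∷ b)) ω
                    | indicator-≟1 (Z zero ω) | indicator-≟0 (Z zero ω) with Z zero ω
    ... | true  = +-identityʳ _
    ... | false = +-identityˡ _

  -- By negative correlation the conditional probability of X ≈ 0# is smallest
  -- given A, hence at most its average over all values of X_S.
  conditional-≤ : ∀ {k} {Z : Fin (suc k) → Ω → Bool} →
    NegativelyCorrelated (λ j → indicator ∘ Z j) → (S : Subset k) →
    let X = indicator ∘ Z zero
        A = agrees (λ j → indicator ∘ Z (suc j)) S (const 0#)
    in 𝔼 (λ ω → (1# - X ω) * A ω) ≤ (1# - 𝔼 X) * 𝔼 A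
  conditional-≤ {k} {Z} nc S with 𝔼 (agrees (λ j → indicator ∘ Z (suc j)) S (const 0#)) ≟ 0#
  -- Negative correlation speaks only of conditioning events of positive probability; on a null
  -- event both sides are bounded through zero directly.
  ... | yes α≈0 = begin
    𝔼 (λ ω → (1# - X ω) * A ω)  ≤⟨ 𝔼-mono-≤ (λ ω → ≤-trans
        (*-monoʳ-≤ (proj₁ (A∈I ω)) (1-x≤1 (proj₁ (indicator-unit (Z zero ω))))) (≤-reflexive (*-identityˡ _))) ⟩
    𝔼 A               ≈⟨ α≈0 ⟩
    0#                ≈⟨ zeroʳ _ ⟨
    (1# - 𝔼 X) * 0#   ≈⟨ *-congˡ α≈0 ⟨
    (1# - 𝔼 X) * 𝔼 A  ∎
    where
    X = indicator ∘ Z zero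
    A = agrees (λ j → indicator ∘ Z (suc j)) S (const 0#)
    A∈I = agrees-unit (λ j → indicator ∘ Z (suc j)) S (const 0#)
  ... | no α≉0 = begin
    𝔼 (λ ω → (1# - X ω) * A (const 0#) ω)  ≈⟨ joint (const 0#) ⟨
    J (const 0#)                           ≈⟨ /-*-cancel _ α≉0 ⟨
    r * 𝔼 (A (const 0#))                   ≤⟨ *-monoʳ-≤ (0≤𝔼A (const 0#)) r≤1-𝔼X ⟩
    (1# - 𝔼 X) * 𝔼 (A (const 0#))          ∎
    where
    X = indicator ∘ Z zero
    A : (Fin k → Carrier) → Ω → Carrier
    A x = agrees (λ j → indicator ∘ Z (suc j)) S x
    J : (Fin k → Carrier) → Carrier
    J x = ℙ (λ ω → (X ω ≤? 0#) ×-dec agreesOn (λ j → indicator ∘ Z (suc j)) S x ω)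
    r = J (const 0#) / 𝔼 (A (const 0#))
    0≤𝔼A : ∀ x → 0# ≤ 𝔼 (A x)
    0≤𝔼A x = 𝔼-nonNeg (λ ω → proj₁ (agrees-unit (λ j → indicator ∘ Z (suc j)) S x ω))
    joint : ∀ x → J x ≈ 𝔼 (λ ω → (1# - X ω) * A x ω)
    joint x = 𝔼-cong λ ω → trans (indicator-∧ (does (X ω ≤? 0#)) _)
      (*-congʳ (trans (reflexive (≡.cong indicator (indicator-≤?0 (Z zero ω)))) (indicator-not (Z zero ω))))
    0≤J : ∀ x → 0# ≤ J x
    0≤J x = 𝔼-nonNeg (λ ω → proj₁ (indicator-unit (does (X ω ≤? 0#) ∧ does (agreesOn (λ j → indicator ∘ Z (suc j)) S x ω))))
    0<𝔼A : ∀ x → ¬ (𝔼 (A x) ≈ 0#) → 0# < 𝔼 (A x)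
    0<𝔼A x 𝔼A≉0 = 0≤𝔼A x , 𝔼A≉0 ∘ sym
    -- Cross-multiplying the comparison of conditional probabilities makes it meaningful for null
    -- cylinders too, where the left side is zero.
    r*𝔼A≤J : ∀ b → r * 𝔼 (A (indicator ∘ b)) ≤ J (indicator ∘ b)
    r*𝔼A≤J b with 𝔼 (A (indicator ∘ b)) ≟ 0#
    ... | yes β≈0 = ≤-trans (≤-reflexive (trans (*-congˡ β≈0) (zeroʳ r))) (0≤J (indicator ∘ b))
    ... | no  β≉0 = begin
      r * 𝔼 (A x)                ≤⟨ *-monoʳ-≤ (0≤𝔼A x)
          (conditional-mono nc zero S (λ ()) 0# (const 0#) x
            (λ j _ → proj₁ (indicator-unit (b j))) (0<𝔼A (const 0#) α≉0) (0<𝔼A x β≉0)) ⟩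
      J x / 𝔼 (A x) * 𝔼 (A x)    ≈⟨ /-*-cancel _ β≉0 ⟩
      J x                        ∎
      where x = indicator ∘ b
    -- Summing the comparison over all cylinders is `nonNeg-on-cylinders` for `1# - X - r`.
    r≤1-𝔼X : r ≤ 1# - 𝔼 X
    r≤1-𝔼X = begin
      r  ≤⟨ ≤-by (nonNeg-on-cylinders (Z ∘ suc) S (λ ω → 1# - X ω - r) cylinder)
              (sym (trans (+-congˡ (𝔼-- (λ ω → 1# - X ω) (const r)))
                (trans (+-congˡ (+-congˡ (-‿cong (𝔼-const r))))
                  (solve 2 (λ r y → r :+ (y :- r) := y) refl r (𝔼 (λ ω → 1# - X ω)))))) ⟩
      𝔼 (λ ω → 1# - X ω)    ≈⟨ 𝔼-- (const 1#) X ⟩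
      𝔼 (const 1#) - 𝔼 X    ≈⟨ +-congʳ (𝔼-const 1#) ⟩
      1# - 𝔼 X              ∎
      where
      cylinder : ∀ b → 0# ≤ 𝔼 (λ ω → (1# - X ω - r) * A (indicator ∘ b) ω)
      cylinder b = begin
        0#                                                 ≤⟨ x≤y⇒0≤y-x (r*𝔼A≤J b) ⟩
        J x - r * 𝔼 (A x)                                  ≈⟨ +-cong (joint x) (-‿cong (sym (𝔼-*ˡ r (A x)))) ⟩
        𝔼 (λ ω → (1# - X ω) * A x ω) - 𝔼 (λ ω → r * A x ω) ≈⟨ 𝔼-- _ _ ⟨
        𝔼 (λ ω → (1# - X ω) * A x ω - r * A x ω)           ≈⟨ 𝔼-cong (λ ω →
            solve 3 (λ y r a → y :* a :- r :* a := (y :- r) :* a) refl (1# - X ω) r (A x ω)) ⟩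
        𝔼 (λ ω → (1# - X ω - r) * A x ω)                   ∎
        where x = indicator ∘ b

  -- The chain rule: the head is compared with the event that no later selected query arrives, and
  -- the tail inherits negative correlation. A head that is not selected contributes the factor 1.
  negativelyCorrelated⇒lowerOrthantDependent : ∀ {k} (Z : Fin k → Ω → Bool) →
    NegativelyCorrelated (λ j → indicator ∘ Z j) → LowerOrthantDependent (λ j → indicator ∘ Z j)
  negativelyCorrelated⇒lowerOrthantDependent {zero}  Z nc b = ≤-reflexive (𝔼-const 1#)
  negativelyCorrelated⇒lowerOrthantDependent {suc k} Z nc b = ≤-trans (head (b zero))
    (*-monoˡ-≤ (proj₁ (1-unit (*-unit (indicator-unit (b zero)) (𝔼-unit (indicator-unit ∘ Z zero)))))
      (negativelyCorrelated⇒lowerOrthantDependent (Z ∘ suc) (negativelyCorrelated-tail nc) (b ∘ suc)))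
    where
    X = indicator ∘ Z zero
    Q : Ω → Carrier
    Q ω = complements (λ j → indicator (b (suc j)) * indicator (Z (suc j) ω))
    A = agrees (λ j → indicator ∘ Z (suc j)) (tabulate (b ∘ suc)) (const 0#)
    A≈Q : ∀ ω → A ω ≈ Q ω
    A≈Q = agrees-at-0 (Z ∘ suc) (b ∘ suc)
    head : ∀ b₀ → 𝔼 (λ ω → (1# - indicator b₀ * X ω) * Q ω) ≤ (1# - indicator b₀ * 𝔼 X) * 𝔼 Q
    head false = ≤-reflexive (trans (𝔼-cong (λ ω → *-congʳ (1-cong (trans (zeroˡ (X ω)) (sym (zeroˡ (𝔼 X)))))))
                                    (𝔼-*ˡ (1# - 0# * 𝔼 X) Q))
    head true = begin
      𝔼 (λ ω → (1# - 1# * X ω) * Q ω)  ≈⟨ 𝔼-cong (λ ω → *-cong (1-cong (*-identityˡ (X ω))) (sym (A≈Q ω))) ⟩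
      𝔼 (λ ω → (1# - X ω) * A ω)       ≤⟨ conditional-≤ nc (tabulate (b ∘ suc)) ⟩
      (1# - 𝔼 X) * 𝔼 A                 ≈⟨ *-cong (1-cong (*-identityˡ (𝔼 X))) (𝔼-cong (sym ∘ A≈Q)) ⟨
      (1# - 1# * 𝔼 X) * 𝔼 Q            ∎

-- Expectation over the algorithm's random choices.

module Choices {c ℓ} (R : CompleteOrderedField c ℓ) {m n : ℕ} (𝓘 : AdCell.Instance R m n) where
  open CompleteOrderedField R hiding (zero)
  open OrderedField R
  open Indicators R
  open Probability R using (indicator; FiniteProbabilitySpace)
  open AdCell R using (𝔼-choices)
  open import Relation.Binary.Reasoning.PartialOrder (TotalOrder.poset totalOrder)

  -- With `nothing` first, expectation over `lawSpace` unfolds to exactly one layer of `𝔼-choices`,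
  -- so the lemmas on finite expectations serve as induction steps.
  choice : Fin (suc m) → Maybe (Fin m)
  choice zero    = nothing
  choice (suc i) = just i

  record Law (q : Maybe (Fin m) → Carrier) : Set (c ⊔ ℓ) where
    field
      nonNeg     : ∀ d → 0# ≤ q d
      normalised : q nothing + sum (q ∘ just) ≈ 1#

    lawSpace : FiniteProbabilitySpace
    lawSpace = record
      { size        = suc m
      ; mass        = q ∘ choice
      ; mass-nonNeg = nonNeg ∘ choice
      ; mass-total  = normalised
      }

    open FiniteProbabilitySpace lawSpace public using (𝔼)
    open Expectation R lawSpace public

  module _ {q : Maybe (Fin m) → Carrier} (law : Law q) where
    open Law law

    𝔼-chosen : ∀ i → 𝔼 (λ a → indicator (does (≡-dec _≟F_ (choice a) (just i)))) ≈ q (just i)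
    𝔼-chosen i = trans (+-cong (zeroʳ _) (sum-δ (q ∘ just) i)) (+-identityˡ _)

    𝔼-complement-chosen : ∀ z b i →
      𝔼 (λ a → 1# - z * indicator (b ∧ does (≡-dec _≟F_ (choice a) (just i)))) ≈
      1# - z * (indicator b * q (just i))
    𝔼-complement-chosen z b i = begin-equality
      𝔼 (λ a → 1# - z * indicator (b ∧ δ a))    ≈⟨ 𝔼-- (const 1#) (λ a → z * indicator (b ∧ δ a)) ⟩
      𝔼 (const 1#) - 𝔼 (λ a → z * indicator (b ∧ δ a))
        ≈⟨ +-cong (𝔼-const 1#) (-‿cong (𝔼-*ˡ z (λ a → indicator (b ∧ δ a)))) ⟩
      1# - z * 𝔼 (λ a → indicator (b ∧ δ a))
        ≈⟨ 1-cong (*-congˡ (trans (𝔼-cong λ a → indicator-∧ b (δ a)) (𝔼-*ˡ (indicator b) (indicator ∘ δ)))) ⟩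
      1# - z * (indicator b * 𝔼 (indicator ∘ δ)) ≈⟨ 1-cong (*-congˡ (*-congˡ (𝔼-chosen i))) ⟩
      1# - z * (indicator b * q (just i))       ∎
      where
      δ : Fin (suc m) → Bool
      δ a = does (≡-dec _≟F_ (choice a) (just i))

  𝔼-choices-mono-≤ : ∀ {k} {q : Fin k → Maybe (Fin m) → Carrier} (law : ∀ j → Law (q j))
    {f g : Vec (Maybe (Fin m)) k → Carrier} → (∀ d → f d ≤ g d) → 𝔼-choices 𝓘 q f ≤ 𝔼-choices 𝓘 q g
  𝔼-choices-mono-≤ {zero}  law f≤g = f≤g []
  𝔼-choices-mono-≤ {suc k} law f≤g =
    Law.𝔼-mono-≤ (law zero) λ a → 𝔼-choices-mono-≤ (law ∘ suc) λ d → f≤g (choice a ∷ d)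

  𝔼-choices-sum : ∀ {k p} {q : Fin k → Maybe (Fin m) → Carrier} (law : ∀ j → Law (q j))
    (f : Fin p → Vec (Maybe (Fin m)) k → Carrier) →
    𝔼-choices 𝓘 q (λ d → sum λ i → f i d) ≈ sum λ i → 𝔼-choices 𝓘 q (f i)
  𝔼-choices-sum {zero}  law f = refl
  𝔼-choices-sum {suc k} {q = q} law f = trans
    (Law.𝔼-cong (law zero) λ a → 𝔼-choices-sum (law ∘ suc) (λ i d → f i (choice a ∷ d)))
    (Law.𝔼-sum (law zero) λ i a → 𝔼-choices 𝓘 (q ∘ suc) (λ d → f i (choice a ∷ d)))

  𝔼-choices-*ˡ : ∀ {k} {q : Fin k → Maybe (Fin m) → Carrier} (law : ∀ j → Law (q j)) b
    (f : Vec (Maybe (Fin m)) k → Carrier) →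
    𝔼-choices 𝓘 q (λ d → b * f d) ≈ b * 𝔼-choices 𝓘 q f
  𝔼-choices-*ˡ {zero}  law b f = refl
  𝔼-choices-*ˡ {suc k} {q} law b f = trans
    (Law.𝔼-cong (law zero) λ a → 𝔼-choices-*ˡ (law ∘ suc) b (λ d → f (choice a ∷ d)))
    (Law.𝔼-*ˡ (law zero) b λ a → 𝔼-choices 𝓘 (q ∘ suc) (λ d → f (choice a ∷ d)))

  𝔼-choices-complement : ∀ {k} {q : Fin k → Maybe (Fin m) → Carrier} (law : ∀ j → Law (q j))
    (f : Vec (Maybe (Fin m)) k → Carrier) →
    𝔼-choices 𝓘 q (λ d → 1# - f d) ≈ 1# - 𝔼-choices 𝓘 q f
  𝔼-choices-complement {zero}  law f = refl
  𝔼-choices-complement {suc k} {q} law f = trans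
    (Law.𝔼-cong (law zero) λ a → 𝔼-choices-complement (law ∘ suc) (λ d → f (choice a ∷ d)))
    (trans (Law.𝔼-- (law zero) (const 1#) λ a → 𝔼-choices 𝓘 (q ∘ suc) (λ d → f (choice a ∷ d)))
           (+-congʳ (Law.𝔼-const (law zero) 1#)))

  𝔼-choices-product : ∀ {k} {q : Fin k → Maybe (Fin m) → Carrier} (law : ∀ j → Law (q j))
    (f : Fin k → Maybe (Fin m) → Carrier) →
    𝔼-choices 𝓘 q (λ d → product λ j → f j (lookup d j)) ≈ product λ j → Law.𝔼 (law j) (f j ∘ choice)
  𝔼-choices-product {zero}  law f = refl
  𝔼-choices-product {suc k} law f = trans
    (Law.𝔼-cong (law zero) λ a → trans (𝔼-choices-*ˡ (law ∘ suc) (f zero (choice a)) _)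
                                       (*-congˡ (𝔼-choices-product (law ∘ suc) (f ∘ suc))))
    (Law.𝔼-*ʳ (law zero) (f zero ∘ choice) _)

-- The AdCell instance: arrivals, algorithm and offline optimum.

module Analysis {c ℓ} (R : CompleteOrderedField c ℓ) {m n : ℕ} (𝓘 : AdCell.Instance R m n) where
  open CompleteOrderedField R hiding (zero)
  open OrderedField R
  open Exponential R
  open Euler R using (e)
  open Indicators R
  open Choices R 𝓘
  open Probability R using (indicator)
  open AdCell R
  open Instance 𝓘
  open Probability.FiniteProbabilitySpace space using (𝔼; Ω)
  open Expectation R space
  open NegativeCorrelation R space using (negativelyCorrelated⇒lowerOrthantDependent)
  open IntegerSolver commutativeRing using (solve; _:=_; _:+_; _:*_; _:-_; con)
  open SemiringSum semiring using (*-distribˡ-sum; *-distribʳ-sum) renaming (sum-cong-≋ to sum-cong)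
  open CommutativeMonoidSum *-commutativeMonoid using ()
    renaming (sum-cong-≋ to product-cong; ∑-comm to product-comm)
  open import Relation.Binary.Reasoning.PartialOrder (TotalOrder.poset totalOrder)

  A : Fin n → Ω → Carrier
  A = arrivalIndicator 𝓘

  𝔼-arrival : ∀ j → 𝔼 (A j) ≈ prob j
  𝔼-arrival j = trans (𝔼-cong λ ω → reflexive (≡.cong indicator (≡.sym (does-∈? j (arrivals ω))))) (marginal j)

  prob-unit : ∀ j → UnitInterval (prob j)
  prob-unit j = ≤-trans (proj₁ A∈I) (≤-reflexive (𝔼-arrival j)) , ≤-trans (≤-reflexive (sym (𝔼-arrival j))) (proj₂ A∈I)
    where A∈I = 𝔼-unit (λ ω → indicator-unit (lookup (arrivals ω) j))

  module _ (arr : CustomerArrivals 𝓘) where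
    open CustomerArrivals arr

    inSlot : ∀ g j → Carrier
    inSlot g j = indicator (does (slot j ≟F g))

    -- Independence factors both sides over the slots; within a slot, exclusivity
    -- gives the bound.
    customerArrivals⇒lowerOrthantDependent : LowerOrthantDependent A
    customerArrivals⇒lowerOrthantDependent b = begin
      𝔼 (λ ω → complements (λ j → indicator (b j) * A j ω))
        ≈⟨ 𝔼-cong (λ ω → by-slots (λ j → indicator (b j) * A j ω)) ⟩
      𝔼 (λ ω → product (λ g → complements (λ j → X g j ω)))
        ≈⟨ 𝔼-cong (λ ω → trans (product-cong λ g → sym (event g ω))
                                 (sym (indicator-all? λ g → T? (B g (arrivals ω ∩ queriesIn g))))) ⟩
      𝔼 (λ ω → indicator (does (all? λ g → T? (B g (arrivals ω ∩ queriesIn g)))))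
        ≈⟨ independent B ⟩
      product (λ g → 𝔼 (λ ω → indicator (B g (arrivals ω ∩ queriesIn g))))
        ≈⟨ product-cong (λ g → 𝔼-cong (event g)) ⟩
      product (λ g → 𝔼 (λ ω → complements (λ j → X g j ω)))
        ≤⟨ product-mono-≤ (λ g → 𝔼-nonNeg λ ω → proj₁ (complements-unit λ j → X∈I g j ω))
                          (λ g → exclusive-complements (X∈I g) (X-exclusive g)) ⟩
      product (λ g → complements (λ j → 𝔼 (X g j)))
        ≈⟨ product-cong (λ g → complements-cong λ j →
             trans (𝔼-*ʳ (λ ω → indicator (b j) * A j ω) (inSlot g j)) (*-congʳ (𝔼-*ˡ (indicator (b j)) (A j)))) ⟩
      product (λ g → complements (λ j → indicator (b j) * 𝔼 (A j) * inSlot g j))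
        ≈⟨ by-slots (λ j → indicator (b j) * 𝔼 (A j)) ⟨
      complements (λ j → indicator (b j) * 𝔼 (A j))  ∎
      where
      by-slots : ∀ v → complements v ≈ product (λ g → complements (λ j → v j * inSlot g j))
      by-slots v = trans (product-cong λ j → sym (complements-δ (v j) (slot j)))
                         (product-comm (λ j g → 1# - v j * inSlot g j))
      X : ∀ g j → Ω → Carrier
      X g j ω = indicator (b j) * A j ω * inSlot g j
      X∈I : ∀ g j ω → UnitInterval (X g j ω)
      X∈I g j ω = *-unit (*-unit (indicator-unit (b j)) (indicator-unit (lookup (arrivals ω) j)))
                         (indicator-unit (does (slot j ≟F g)))
      -- The test that no selected query of slot `g` arrives. It reads only the arrivals within the
      -- slot, which are the variables assumed independent.
      B : ∀ g → Subset n → Bool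
      B g y = does (all? λ j → T? (not (b j ∧ lookup y j)))
      event : ∀ g ω → indicator (B g (arrivals ω ∩ queriesIn g)) ≈ complements (λ j → X g j ω)
      event g ω = trans (indicator-all? (λ j → T? (not (b j ∧ lookup (arrivals ω ∩ queriesIn g) j))))
                        (product-cong factor)
        where
        factor : ∀ j → indicator (not (b j ∧ lookup (arrivals ω ∩ queriesIn g) j)) ≈ 1# - X g j ω
        factor j rewrite lookup-zipWith _∧_ j (arrivals ω) (queriesIn g)
                       | lookup∘tabulate (λ j → does (slot j ≟F g)) j =
          trans (indicator-nand (b j) _)
                (1-cong (trans (*-congˡ (indicator-∧ (lookup (arrivals ω) j) _)) (sym (*-assoc _ _ _))))
      -- Unless both queries lie in slot `g`, a slot indicator vanishes; if both do, injectivity of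
      -- `combine` recovers the common customer and time.
      X-exclusive : ∀ g {j l} → j ≢ l → 𝔼 (λ ω → X g j ω * X g l ω) ≈ 0#
      X-exclusive g {j} {l} j≢l = begin-equality
        𝔼 (λ ω → X g j ω * X g l ω)
          ≈⟨ 𝔼-cong (λ ω → solve 6 (λ b A s b′ A′ s′ → b :* A :* s :* (b′ :* A′ :* s′) :=
               b :* b′ :* (s :* s′) :* (A :* A′)) refl (indicator (b j)) (A j ω) (inSlot g j)
                 (indicator (b l)) (A l ω) (inSlot g l)) ⟩
        𝔼 (λ ω → indicator (b j) * indicator (b l) * (inSlot g j * inSlot g l) * (A j ω * A l ω))
          ≈⟨ 𝔼-*ˡ _ _ ⟩
        indicator (b j) * indicator (b l) * (inSlot g j * inSlot g l) * 𝔼 (λ ω → A j ω * A l ω)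
          ≈⟨ *-assoc _ _ _ ⟩
        indicator (b j) * indicator (b l) * (inSlot g j * inSlot g l * 𝔼 (λ ω → A j ω * A l ω))
          ≈⟨ trans (*-congˡ same-slot) (zeroʳ _) ⟩
        0#  ∎
        where
        both : ∀ ω → A j ω * A l ω ≈ indicator (does ((j ∈? arrivals ω) ×-dec (l ∈? arrivals ω)))
        both ω rewrite does-∈? j (arrivals ω) | does-∈? l (arrivals ω) = sym (indicator-∧ (lookup (arrivals ω) j) _)
        same-slot : inSlot g j * inSlot g l * 𝔼 (λ ω → A j ω * A l ω) ≈ 0#
        same-slot with slot j ≟F g | slot l ≟F g
        ... | no  _  | _      = trans (*-congʳ (zeroˡ _)) (zeroˡ _)
        ... | yes _  | no _   = trans (*-congʳ (zeroʳ _)) (zeroˡ _)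
        ... | yes j∈g | yes l∈g =
          let same-customer , same-time = combine-injective _ _ _ _ (≡.trans j∈g (≡.sym l∈g))
          in trans (*-congˡ (trans (𝔼-cong both) (exclusive j≢l same-customer same-time))) (zeroʳ _)

  arrivals-lowerOrthantDependent : CustomerArrivals 𝓘 ⊎ NegativelyCorrelatedArrivals 𝓘 → LowerOrthantDependent A
  arrivals-lowerOrthantDependent (inj₁ arr) = customerArrivals⇒lowerOrthantDependent arr
  arrivals-lowerOrthantDependent (inj₂ nc)  =
    negativelyCorrelated⇒lowerOrthantDependent (λ j ω → lookup (arrivals ω) j) nc

  module _ {x : Fractional 𝓘} (feasible : IsFeasible 𝓘 x) where
    open IsFeasible feasible

    q : Fin n → Maybe (Fin m) → Carrier
    q = choiceProb 𝓘 x

    -- All x i j with prob j ≈ 0# vanish, whatever the value of 0# ⁻¹.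
    x≈0 : ∀ {j} → prob j ≈ 0# → ∀ i → x i j ≈ 0#
    x≈0 {j} p≈0 i = antisym
      (≤-trans (term≤sum (λ i → nonNeg i j) i) (≤-trans (query-constraint j) (≤-reflexive p≈0)))
      (nonNeg i j)

    q-just-nonNeg : ∀ j i → 0# ≤ q j (just i)
    q-just-nonNeg j i with prob j ≟ 0#
    ... | yes p≈0 = ≤-reflexive (sym (trans (*-congʳ (x≈0 p≈0 i)) (zeroˡ _)))
    ... | no  p≉0 = *-nonNeg (nonNeg i j) (⁻¹-nonNeg (proj₁ (prob-unit j)) p≉0)

    q*prob≈x : ∀ j i → q j (just i) * prob j ≈ x i j
    q*prob≈x j i with prob j ≟ 0#
    ... | yes p≈0 = trans (*-congˡ p≈0) (trans (zeroʳ _) (sym (x≈0 p≈0 i)))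
    ... | no  p≉0 = /-*-cancel (x i j) p≉0

    sum-q≤1 : ∀ j → sum (λ i → q j (just i)) ≤ 1#
    sum-q≤1 j with prob j ≟ 0#
    ... | yes p≈0 = begin
      sum (λ i → x i j / prob j)  ≈⟨ *-distribʳ-sum _ (λ i → x i j) ⟨
      sum (λ i → x i j) / prob j  ≤⟨ ≤-reflexive (*-congʳ (antisym
          (≤-trans (query-constraint j) (≤-reflexive p≈0)) (sum-nonNeg λ i → nonNeg i j))) ⟩
      0# / prob j                 ≈⟨ zeroˡ _ ⟩
      0#                          ≤⟨ 0≤1 ⟩
      1#                          ∎
    ... | no p≉0 = begin
      sum (λ i → x i j / prob j)  ≈⟨ *-distribʳ-sum _ (λ i → x i j) ⟨
      sum (λ i → x i j) / prob j  ≤⟨ /-≤1 (proj₁ (prob-unit j)) p≉0 (query-constraint j) ⟩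
      1#                          ∎

    law : ∀ j → Law (q j)
    law j = record
      { nonNeg     = q-nonNeg
      ; normalised = solve 1 (λ s → con (+ 1) :- s :+ s := con (+ 1)) refl (sum (q j ∘ just))
      }
      where
      q-nonNeg : ∀ d → 0# ≤ q j d
      q-nonNeg nothing  = x≤y⇒0≤y-x (sum-q≤1 j)
      q-nonNeg (just i) = q-just-nonNeg j i

    q-unit : ∀ j i → UnitInterval (q j (just i))
    q-unit j i = q-just-nonNeg j i , ≤-trans (term≤sum (q-just-nonNeg j) i) (sum-q≤1 j)

    -- `Instance` does not postulate this; the existence of a feasible point forces it, even when
    -- there are no queries.
    budget-nonNeg : ∀ i → 0# ≤ budget i
    budget-nonNeg i = ≤-trans (sum-nonNeg λ j → *-nonNeg (nonNeg i j) (bid-nonNeg i j)) (budget-constraint i)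

    private
      a : Fin m → Fin n → Carrier
      a i j = proj₁ (ratio (bid-nonNeg i j) (bid≤budget i j))

      a-unit : ∀ i j → UnitInterval (a i j)
      a-unit i j with ratio (bid-nonNeg i j) (bid≤budget i j)
      ... | _ , 0≤r , r≤1 , _ = 0≤r , r≤1

      a*budget≈bid : ∀ i j → a i j * budget i ≈ bid i j
      a*budget≈bid i j = proj₂ (proj₂ (proj₂ (ratio (bid-nonNeg i j) (bid≤budget i j))))

      budget*sum≈ : ∀ i (v : Fin n → Carrier) → budget i * sum (λ j → a i j * v j) ≈ sum (λ j → v j * bid i j)
      budget*sum≈ i v = trans (*-distribˡ-sum (budget i) (λ j → a i j * v j)) (sum-cong λ j → begin-equality
        budget i * (a i j * v j)  ≈⟨ solve 3 (λ b a v → b :* (a :* v) := v :* (a :* b)) refl (budget i) (a i j) (v j) ⟩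
        v j * (a i j * budget i)  ≈⟨ *-congˡ (a*budget≈bid i j) ⟩
        v j * bid i j             ∎)

    revenue-lower-bound : ∀ X → sum (λ i → budget i * (1# - complements (λ j → a i j * indicator (X i j)))) ≤ revenue 𝓘 X
    revenue-lower-bound X = sum-mono-≤ λ i → ≤-trans
      (⊓-lower-bound (budget-nonNeg i) (λ j → *-unit (a-unit i j) (indicator-unit (X i j))))
      (⊓-monoˡ-≤ (budget i) (≤-reflexive (budget*sum≈ i (λ j → indicator (X i j)))))

    -- With the arrivals fixed the choices are independent, so the mean of each product is the
    -- product of the means.
    choices-lower-bound : ∀ I →
      sum (λ i → budget i * (1# - complements (λ j → a i j * q j (just i) * indicator (lookup I j)))) ≤
      𝔼-choices 𝓘 q (λ d → revenue 𝓘 (allocate 𝓘 I d))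
    choices-lower-bound I = begin
      sum (λ i → budget i * (1# - complements (λ j → a i j * q j (just i) * indicator (lookup I j))))
        ≈⟨ sum-cong (λ i → *-congˡ (1-cong (sym (per-advertiser i)))) ⟩
      sum (λ i → budget i * (1# - 𝔼-choices 𝓘 q (P i)))
        ≈⟨ sum-cong (λ i → trans (*-congˡ (sym (𝔼-choices-complement law (P i)))) (sym (𝔼-choices-*ˡ law (budget i) _))) ⟩
      sum (λ i → 𝔼-choices 𝓘 q (λ d → budget i * (1# - P i d)))
        ≈⟨ 𝔼-choices-sum law (λ i d → budget i * (1# - P i d)) ⟨
      𝔼-choices 𝓘 q (λ d → sum (λ i → budget i * (1# - P i d)))
        ≤⟨ 𝔼-choices-mono-≤ law (λ d → revenue-lower-bound (allocate 𝓘 I d)) ⟩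
      𝔼-choices 𝓘 q (λ d → revenue 𝓘 (allocate 𝓘 I d))  ∎
      where
      P : Fin m → Vec (Maybe (Fin m)) n → Carrier
      P i d = complements (λ j → a i j * indicator (allocate 𝓘 I d i j))
      per-advertiser : ∀ i → 𝔼-choices 𝓘 q (P i) ≈ complements (λ j → a i j * q j (just i) * indicator (lookup I j))
      per-advertiser i = trans
        (𝔼-choices-product law (λ j d → 1# - a i j * indicator (lookup I j ∧ does (≡-dec _≟F_ d (just i)))))
        (product-cong λ j → trans (𝔼-complement-chosen (law j) (a i j) (lookup I j) i)
          (1-cong (solve 3 (λ a I q → a :* (I :* q) := a :* q :* I) refl (a i j) (indicator (lookup I j)) (q j (just i)))))

    -- The inequality on the cube is used at `zⱼ = a i j * q j (just i)`. Then
    -- `zⱼ * prob j ≈ a i j * x i j`, the fraction of the budget that the LP spends on query `j`,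
    -- and the budget constraint bounds the total weight.
    algorithm-lower-bound : LowerOrthantDependent A → (1# - e ⁻¹) * lpValue 𝓘 x ≤ expectedRevenueA 𝓘 x
    algorithm-lower-bound lod = begin
      (1# - e ⁻¹) * lpValue 𝓘 x
        ≈⟨ *-distribˡ-sum (1# - e ⁻¹) (λ i → sum (λ j → x i j * bid i j)) ⟩
      sum (λ i → (1# - e ⁻¹) * sum (λ j → x i j * bid i j))
        ≤⟨ sum-mono-≤ per-advertiser ⟩
      sum (λ i → 𝔼 (λ ω → budget i * (1# - P i ω)))
        ≈⟨ 𝔼-sum (λ i ω → budget i * (1# - P i ω)) ⟨
      𝔼 (λ ω → sum (λ i → budget i * (1# - P i ω)))
        ≤⟨ 𝔼-mono-≤ (λ ω → choices-lower-bound (arrivals ω)) ⟩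
      expectedRevenueA 𝓘 x  ∎
      where
      P : Fin m → Ω → Carrier
      P i ω = complements (λ j → a i j * q j (just i) * A j ω)
      per-advertiser : ∀ i → (1# - e ⁻¹) * sum (λ j → x i j * bid i j) ≤ 𝔼 (λ ω → budget i * (1# - P i ω))
      per-advertiser i = begin
        (1# - e ⁻¹) * sum (λ j → x i j * bid i j)
          ≈⟨ *-congˡ (budget*sum≈ i (x i)) ⟨
        (1# - e ⁻¹) * (budget i * sum (λ j → a i j * x i j))
          ≤⟨ scaled-complements-bound (budget-nonNeg i) (λ j → *-unit (a-unit i j) (nonNeg i j , ≤1 i j))
               (≤-trans (≤-reflexive (budget*sum≈ i (x i))) (budget-constraint i)) ⟩
        budget i * (1# - complements (λ j → a i j * x i j))
          ≈⟨ *-congˡ (1-cong (complements-cong λ j → trans (*-assoc _ _ _)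
               (*-congˡ (trans (*-congˡ (𝔼-arrival j)) (q*prob≈x j i))))) ⟨
        budget i * (1# - complements (λ j → a i j * q j (just i) * 𝔼 (A j)))
          ≤⟨ *-monoˡ-≤ (budget-nonNeg i) (1-mono-≥ (𝔼-complements-≤ lod (λ j → *-unit (a-unit i j) (q-unit j i)))) ⟩
        budget i * (1# - 𝔼 (P i))
          ≈⟨ *-congˡ (trans (𝔼-- (const 1#) (P i)) (+-congʳ (𝔼-const 1#))) ⟨
        budget i * 𝔼 (λ ω → 1# - P i ω)
          ≈⟨ 𝔼-*ˡ (budget i) _ ⟨
        𝔼 (λ ω → budget i * (1# - P i ω))  ∎

  -- An offline allocation may exceed a budget; scaling the overspending
  -- advertisers' shares down before averaging gives a feasible LP solution.
  module _ (0≤budget : ∀ i → 0# ≤ budget i) (opt : Subset n → Allocation 𝓘)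
           (opt-allocation : ∀ I → IsAllocationFor 𝓘 I (opt I)) where

    X : Fin m → Fin n → Ω → Carrier
    X i j ω = indicator (opt (arrivals ω) i j)

    spending : Fin m → Ω → Carrier
    spending i ω = sum λ j → X i j ω * bid i j

    -- The factor depends on the outcome, so the scaled shares spend exactly the capped revenue
    -- pointwise and averaging preserves the objective.
    spending-ratio : ∀ i ω → ∃ λ r → 0# ≤ r × r ≤ 1# × r * spending i ω ≈ spending i ω ⊓ budget i
    spending-ratio i ω = ratio
      (⊓-glb (sum-nonNeg λ j → *-nonNeg (proj₁ (indicator-unit (opt (arrivals ω) i j))) (bid-nonNeg i j)) (0≤budget i))
      (x⊓y≤x (spending i ω) (budget i))

    τ : Fin m → Ω → Carrier
    τ i ω = proj₁ (spending-ratio i ω)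

    share : Fin m → Fin n → Ω → Carrier
    share i j ω = τ i ω * X i j ω

    share-unit : ∀ i j ω → UnitInterval (share i j ω)
    share-unit i j ω with spending-ratio i ω
    ... | _ , 0≤r , r≤1 , _ = *-unit (0≤r , r≤1) (indicator-unit (opt (arrivals ω) i j))

    share≤X : ∀ i j ω → share i j ω ≤ X i j ω
    share≤X i j ω with spending-ratio i ω
    ... | _ , 0≤r , r≤1 , _ =
      ≤-trans (*-monoʳ-≤ (proj₁ (indicator-unit (opt (arrivals ω) i j))) r≤1) (≤-reflexive (*-identityˡ _))

    averaged : Fractional 𝓘
    averaged i j = 𝔼 (share i j)

    averaged-revenue : ∀ i → sum (λ j → averaged i j * bid i j) ≈ 𝔼 (λ ω → spending i ω ⊓ budget i)
    averaged-revenue i = begin-equality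
      sum (λ j → 𝔼 (share i j) * bid i j)            ≈⟨ sum-cong (λ j → sym (𝔼-*ʳ (share i j) (bid i j))) ⟩
      sum (λ j → 𝔼 (λ ω → share i j ω * bid i j))    ≈⟨ 𝔼-sum (λ j ω → share i j ω * bid i j) ⟨
      𝔼 (λ ω → sum (λ j → share i j ω * bid i j))    ≈⟨ 𝔼-cong (λ ω → sum-cong λ j → *-assoc (τ i ω) (X i j ω) (bid i j)) ⟩
      𝔼 (λ ω → sum (λ j → τ i ω * (X i j ω * bid i j)))
        ≈⟨ 𝔼-cong (λ ω → sym (*-distribˡ-sum (τ i ω) (λ j → X i j ω * bid i j))) ⟩
      𝔼 (λ ω → τ i ω * spending i ω)                 ≈⟨ 𝔼-cong (λ ω → proj₂ (proj₂ (proj₂ (spending-ratio i ω)))) ⟩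
      𝔼 (λ ω → spending i ω ⊓ budget i)              ∎

    averaged-feasible : IsFeasible 𝓘 averaged
    averaged-feasible = record
      { query-constraint  = λ j → begin
          sum (λ i → 𝔼 (share i j))          ≈⟨ 𝔼-sum (λ i → share i j) ⟨
          𝔼 (λ ω → sum (λ i → share i j ω))  ≤⟨ 𝔼-mono-≤ (λ ω → ≤-trans (sum-mono-≤ λ i → share≤X i j ω)
                                                                      (opt-allocation (arrivals ω) j)) ⟩
          𝔼 (A j)                            ≈⟨ 𝔼-arrival j ⟩
          prob j                             ∎
      ; budget-constraint = λ i → begin
          sum (λ j → averaged i j * bid i j)  ≈⟨ averaged-revenue i ⟩
          𝔼 (λ ω → spending i ω ⊓ budget i)   ≤⟨ 𝔼-mono-≤ (λ ω → x⊓y≤y (spending i ω) (budget i)) ⟩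
          𝔼 (const (budget i))                ≈⟨ 𝔼-const (budget i) ⟩
          budget i                            ∎
      ; nonNeg            = λ i j → proj₁ (𝔼-unit (share-unit i j))
      ; ≤1                = λ i j → proj₂ (𝔼-unit (share-unit i j))
      }

    expectedOfflineRevenue≈lpValue : expectedOfflineRevenue 𝓘 opt ≈ lpValue 𝓘 averaged
    expectedOfflineRevenue≈lpValue = trans (𝔼-sum (λ i ω → spending i ω ⊓ budget i))
                                           (sum-cong λ i → sym (averaged-revenue i))

theorem1 : ∀ {c ℓ} (R : CompleteOrderedField c ℓ) →
    let open CompleteOrderedField R
        open Euler R
        open AdCell R
    in
    ∀ {m n : ℕ} (𝓘 : Instance m n) →
    CustomerArrivals 𝓘 ⊎ NegativelyCorrelatedArrivals 𝓘 →
    ∀ (x* : Fractional 𝓘) → IsOptimalLP 𝓘 x* →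
    ((1# - e ⁻¹) * lpValue 𝓘 x* ≤ expectedRevenueA 𝓘 x*) ×
    (∀ opt → IsOptimalOffline 𝓘 opt →
      (1# - e ⁻¹) * expectedOfflineRevenue 𝓘 opt ≤ expectedRevenueA 𝓘 x*)
theorem1 R 𝓘 arr x* (feasible , optimal) = online , λ opt opt-optimal →
  -- The LP solution also supplies the sign of the budgets that the offline comparison requires.
  let 0≤budget = budget-nonNeg feasible
      opt-allocation = proj₁ ∘ opt-optimal
  in ≤-trans (*-monoˡ-≤ (proj₁ (1-unit e⁻¹-unit))
       (≤-trans (≤-reflexive (expectedOfflineRevenue≈lpValue 0≤budget opt opt-allocation))
                (optimal _ (averaged-feasible 0≤budget opt opt-allocation))))
     online
  where
  open CompleteOrderedField R using (≤-trans; ≤-reflexive)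
  open OrderedField R using (*-monoˡ-≤; 1-unit)
  open Exponential R using (e⁻¹-unit)
  open Analysis R 𝓘
  online = algorithm-lower-bound feasible (arrivals-lowerOrthantDependent arr)
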